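{- Let $f$ be an almost-full, measurable (partial) function from $[0,1]$ to $[-1,1]$, and let rationals $u,v$ be given with $-1\le u<v\le1$. Then there exists a real $y$ with $u<y<v$ such that the set $\{x\in[0,1]\mid x\in\mathrm{Dom}(f)\wedge(f(x)<y\vee y<f(x))\}$ is almost-full.
   Context: Setting: intuitionistic mathematics (intuitionistic logic), assuming Brouwer's Continuity Principle, the Fan Theorem and the axioms of countable choice. Reals: shrinking, dwindling sequences of pairs of rationals, with $x<y\iff\exists n[x''(n)<y'(n)]$; $[a,b]$ closed intervals of reals. Let $(q_0,r_0),(q_1,r_1),\dots$ enumerate all pairs of rationals $q\le r$. For $\alpha\in\omega^\omega$, $\mathcal{H}_\alpha=\{x\in\mathcal{R}\mid\exists j[q_{\alpha(j)}<x<r_{\alpha(j)}]\}$; for a finite sequence $a$, $\mathcal{H}_a$ is the analogous finite union, and $\mu(a)$ is the total length of the union of the intervals $(q_{a(j)},r_{a(j)})$ (sum of lengths after rewriting as a disjoint increasing family); $\alpha$ is measurable iff $\mu(\alpha):=\lim_n\mu(\langle\alpha(0),\dots,\alpha(n-1)\rangle)$ exists. $\mathcal{X}\subseteq[0,1]$ is almost-full iff for each $n$ there is a measurable $\alpha$ with $\mu(\alpha)<2^{ -n}$ and $\forall x\in[0,1][x\notin\mathcal{H}_\alpha\rightarrow x\in\mathcal{X}]$. A partial function $f$ from $[0,1]$ to $[-1,1]$ (respecting real equality) is almost-full iff $\mathrm{Dom}(f)$ is almost-full. Such $f$ is measurable iff for each $n$ one may find $m$, rationals $u_0,\dots,u_{2^m-1}\in[-1,1]$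 and a measurable $\alpha$ with $\mu(\alpha)<2^{ -n-2}$ such that for all $x\in\mathrm{Dom}(f)$ and $i<2^m$: if $x\notin\mathcal{H}_\alpha$ and $\frac{i}{2^m}<x<\frac{i+1}{2^m}$ then $|f(x)-u_i|<2^{ -n-1}$. -}

module Defs where

open import Data.Nat as ℕ using (ℕ; zero; suc)
open import Data.Bool using (Bool; true; false)
open import Data.Fin using (Fin; toℕ)
open import Data.List using (List; []; _∷_; map; upTo)
open import Data.Integer using (+_)
open import Data.Rational
  using (ℚ; 0ℚ; 1ℚ; ½; _+_; _*_; _-_; -_; _⊔_; _≤?_; _<_; _≤_; _/_)
open import Data.Product using (Σ; _×_; _,_)
open import Data.Sum using (_⊎_)
open import Relation.Nullary using (¬_; yes; no)
open import Relation.Binary.PropositionalEquality using (_≡_; subst; sym)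
open import Data.Rational using (Positive)
open import Data.Rational.Properties using (pos*pos⇒pos; +-inverseʳ; positive⁻¹; ≤-refl)

pow2inv : ℕ → ℚ
pow2inv zero    = 1ℚ
pow2inv (suc m) = ½ * pow2inv m

ℕtoℚ : ℕ → ℚ
ℕtoℚ n = (+ n) / 1

record ℝ : Set where
  field
    lo  : ℕ → ℚ
    hi  : ℕ → ℚ
    lo≤hi    : ∀ n → lo n ≤ hi n
    lo-mono  : ∀ n → lo n ≤ lo (suc n)
    hi-mono  : ∀ n → hi (suc n) ≤ hi n
    dwindle  : ∀ m → Σ ℕ λ n → hi n - lo n < pow2inv m
open ℝ public

_<ℝ_ : ℝ → ℝ → Set
x <ℝ y = Σ ℕ λ n → hi x n < lo y n

_≤ℝ_ : ℝ → ℝ → Set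
x ≤ℝ y = ¬ (y <ℝ x)

_=ℝ_ : ℝ → ℝ → Set
x =ℝ y = ¬ (x <ℝ y) × ¬ (y <ℝ x)

pow2inv-pos : ∀ m → Positive (pow2inv m)
pow2inv-pos zero    = _
pow2inv-pos (suc m) = pos*pos⇒pos ½ {{_}} (pow2inv m) {{pow2inv-pos m}}

q-q<pow2inv : ∀ q m → q - q < pow2inv m
q-q<pow2inv q m =
  subst (_< pow2inv m) (sym (+-inverseʳ q)) (positive⁻¹ (pow2inv m) {{pow2inv-pos m}})

emb : ℚ → ℝ
emb q = record
  { lo = λ _ → q ; hi = λ _ → q
  ; lo≤hi = λ _ → ≤-refl
  ; lo-mono = λ _ → ≤-refl
  ; hi-mono = λ _ → ≤-refl
  ; dwindle = λ m → 0 , q-q<pow2inv q m }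

In01 : ℝ → Set
In01 x = emb 0ℚ ≤ℝ x × x ≤ℝ emb 1ℚ

-- Rational intervals (q,r) with q ≤ r; α ∈ ω^ω is read via the
-- enumeration as a sequence of such pairs.

record Pair : Set where
  constructor ⟨_,_∣_⟩
  field
    pq  : ℚ
    pr  : ℚ
    q≤r : pq ≤ pr
open Pair public

InH : (ℕ → Pair) → ℝ → Set
InH α x = Σ ℕ λ j → (emb (pq (α j)) <ℝ x) × (x <ℝ emb (pr (α j)))

-- μ of a finite list of intervals: length of their union, computed by
-- sorting on left endpoints and merging into a disjoint increasing family.
insert : Pair → List Pair → List Pair
insert p [] = p ∷ []
insert p (p' ∷ ps) with pq p ≤? pq p'
... | yes _ = p ∷ p' ∷ ps
... | no  _ = p' ∷ insert p ps

sortPairs : List Pair → List Pair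
sortPairs []       = []
sortPairs (p ∷ ps) = insert p (sortPairs ps)

-- merging: current block (s,e)
mergeLen : ℚ → ℚ → List Pair → ℚ
mergeLen s e [] = e - s
mergeLen s e (p ∷ ps) with pq p ≤? e
... | yes _ = mergeLen s (e ⊔ pr p) ps
... | no  _ = (e - s) + mergeLen (pq p) (pr p) ps

unionLen : List Pair → ℚ
unionLen ps with sortPairs ps
... | []       = 0ℚ
... | (p ∷ qs) = mergeLen (pq p) (pr p) qs

μfin : (ℕ → Pair) → ℕ → ℚ
μfin α n = unionLen (map α (upTo n))

IsLimit : (ℕ → ℚ) → ℝ → Set
IsLimit s L = ∀ m → Σ ℕ λ N → ∀ k → N ℕ.≤ k →
  (emb (s k - pow2inv m) <ℝ L) × (L <ℝ emb (s k + pow2inv m))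

MeasurableBelow : (ℕ → Pair) → ℚ → Set
MeasurableBelow α ε = Σ ℝ λ L → IsLimit (μfin α) L × (L <ℝ emb ε)

AlmostFull : (ℝ → Set) → Set
AlmostFull X = ∀ n → Σ (ℕ → Pair) λ α → MeasurableBelow α (pow2inv n) ×
  (∀ x → In01 x → ¬ InH α x → X x)

record PFun : Set₁ where
  field
    Dom      : ℝ → Set
    app      : (x : ℝ) → Dom x → ℝ
    dom⊆01   : ∀ x → Dom x → In01 x
    range    : ∀ x (d : Dom x) → (emb (- 1ℚ) ≤ℝ app x d) × (app x d ≤ℝ emb 1ℚ)
    dom-resp : ∀ x y → x =ℝ y → Dom x → Dom y
    app-resp : ∀ x y (d : Dom x) (e : Dom y) → x =ℝ y → app x d =ℝ app y e
open PFun public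

AlmostFullFun : PFun → Set
AlmostFullFun f = AlmostFull (Dom f)

AbsDiffLt : ℝ → ℚ → ℚ → Set
AbsDiffLt z u ε = (emb (u - ε) <ℝ z) × (z <ℝ emb (u + ε))

MeasurableFun : PFun → Set
MeasurableFun f = ∀ n → Σ ℕ λ m → Σ (Fin (2 ℕ.^ m) → ℚ) λ u →
  (∀ i → (- 1ℚ ≤ u i) × (u i ≤ 1ℚ)) ×
  Σ (ℕ → Pair) λ α → MeasurableBelow α (pow2inv (n ℕ.+ 2)) ×
  (∀ x (d : Dom f x) (i : Fin (2 ℕ.^ m)) → ¬ InH α x →
     emb (ℕtoℚ (toℕ i) * pow2inv m) <ℝ x →
     x <ℝ emb (ℕtoℚ (suc (toℕ i)) * pow2inv m) →
     AbsDiffLt (app f x d) (u i) (pow2inv (n ℕ.+ 1)))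

-- Fan Theorem (standing assumption of the paper), decidable-bar form on
-- Cantor space.

prefix : (ℕ → Bool) → ℕ → List Bool
prefix γ n = map γ (upTo n)

FanTheorem : Set
FanTheorem = (B : List Bool → Bool) →
  (∀ γ → Σ ℕ λ n → B (prefix γ n) ≡ true) →
  Σ ℕ λ N → ∀ γ → Σ ℕ λ n → (n ℕ.≤ N) × (B (prefix γ n) ≡ true)

{-# OPTIONS --safe #-}

-- Fix n. By measurability, f is within η of a dyadic step function with values u_i outside a set
-- of small measure. Halving the current interval for y repeatedly and always keeping the half
-- whose u_i occupy less of [0,1] yields a subinterval that contains the values u_i of dyadic
-- intervals of small total length only. Delete these dyadic intervals, and small neighbourhoods
-- of the dyadic points: for the remaining x in Dom(f) one can find i with i/2^m < x < (i+1)/2^m,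
-- and f(x) stays outside the subinterval shrunk by η. Iterating over n, y is the common point of
-- the nested subintervals.
module Submission where

open import Defs
open import Data.Rational
open import Data.Rational.Properties
open import Data.Rational.Solver using (module +-*-Solver)
import Data.Rational.Unnormalised as ℚᵘ
import Data.Rational.Unnormalised.Properties as ℚᵘₚ
open import Data.Fin using (Fin; toℕ; fromℕ<)
open import Data.Fin.Properties using (toℕ-fromℕ<)
import Data.Integer as ℤ
import Data.Integer.Properties as ℤₚ
open import Data.List using (List; []; _∷_; map; filter; reverse; tabulate; upTo; applyDownFrom)
open import Data.List.Membership.Propositional using (_∈_)
open import Data.List.Membership.Propositional.Properties using (∈-filter⁺; ∈-map⁺; ∈-tabulate⁺)
open import Data.List.Properties using (map-upTo; reverse-applyUpTo)
open import Data.List.Relation.Binary.Permutation.Propositional using (_↭_; refl; prep; swap; trans; ↭-sym; ↭-reflexive)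
open import Data.List.Relation.Binary.Permutation.Propositional.Properties using (↭-reverse; All-resp-↭)
open import Data.List.Relation.Binary.Sublist.Propositional using (_⊆_; []; _∷_; _∷ʳ_)
open import Data.List.Relation.Unary.All as All using (All; []; _∷_)
open import Data.List.Relation.Unary.AllPairs using (AllPairs; []; _∷_)
open import Data.Nat as ℕ using (ℕ; zero; suc)
import Data.Nat.Properties as ℕₚ
open import Data.Product using (Σ; _×_; _,_; proj₁; proj₂)
open import Data.Sum as Sum using (_⊎_; inj₁; inj₂)
open import Level using (0ℓ)
open import Relation.Nullary using (yes; no; ¬_; contradiction)
open import Relation.Nullary.Decidable using (¬?)
open import Relation.Unary using (Pred; Decidable)
open import Relation.Binary.PropositionalEquality as ≡ using (_≡_; sym; cong; cong₂; subst; module ≡-Reasoning)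
open +-*-Solver using (solve; con; _:+_; _:*_; _:-_; :-_; _:=_)

-- Two constructive obstacles shape the proof. A measurable sequence needs lengths that converge,
-- and a bounded monotone sequence of rationals need not converge; hence every operation on
-- coverings has to carry a modulus along. Strong subadditivity supplies it: each step enlarges the
-- length of a union by no more than it enlarges the sum of the separate lengths, so a modulus for
-- the sum serves for the union (`convergesBelow-dominated`). The other obstacle is that the order
-- of the reals is undecidable. The choice of a half compares two finite sums of rational widths, so
-- it is decidable. A point `x` can be compared with a grid point once it is known to lie outside a
-- neighbourhood of that point, by cotransitivity of the order.

-- Linear inequalities between rationals, reduced to one known inequality and a ring identity

≤-fromDifference : ∀ {p q x y} → p ≤ q → y - x ≡ q - p → x ≤ y
≤-fromDifference {p} {q} {x} {y} p≤q eq = begin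
  x                  ≡⟨ solve 2 (λ q x → x := q :+ (x :- q)) ≡.refl p x ⟩
  p + (x - p)        ≤⟨ +-monoˡ-≤ (x - p) p≤q ⟩
  q + (x - p)        ≡⟨ solve 3 (λ p q x → q :+ (x :- p) := (q :- p) :+ x) ≡.refl p q x ⟩
  (q - p) + x        ≡⟨ cong (_+ x) (sym eq) ⟩
  (y - x) + x        ≡⟨ solve 2 (λ x y → (y :- x) :+ x := y) ≡.refl x y ⟩
  y                  ∎
  where open ≤-Reasoning

<-fromDifference : ∀ {p q x y} → p < q → y - x ≡ q - p → x < y
<-fromDifference {p} {q} {x} {y} p<q eq = begin-strict
  x                  ≡⟨ solve 2 (λ q x → x := q :+ (x :- q)) ≡.refl p x ⟩
  p + (x - p)        <⟨ +-monoˡ-< (x - p) p<q ⟩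
  q + (x - p)        ≡⟨ solve 3 (λ p q x → q :+ (x :- p) := (q :- p) :+ x) ≡.refl p q x ⟩
  (q - p) + x        ≡⟨ cong (_+ x) (sym eq) ⟩
  (y - x) + x        ≡⟨ solve 2 (λ x y → (y :- x) :+ x := y) ≡.refl x y ⟩
  y                  ∎
  where open ≤-Reasoning

x≤y⇒x-y≤0 : ∀ {x y} → x ≤ y → x - y ≤ 0ℚ
x≤y⇒x-y≤0 {x} {y} x≤y = ≤-fromDifference x≤y
  (solve 2 (λ x y → con 0ℚ :- (x :- y) := y :- x) ≡.refl x y)

x≤y⇒0≤y-x : ∀ {x y} → x ≤ y → 0ℚ ≤ y - x
x≤y⇒0≤y-x {x} {y} x≤y = ≤-fromDifference x≤y
  (solve 2 (λ x y → y :- x :- con 0ℚ := y :- x) ≡.refl x y)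

p≤p+q : ∀ {p q} → 0ℚ ≤ q → p ≤ p + q
p≤p+q {p} {q} 0≤q = ≤-fromDifference 0≤q
  (solve 2 (λ p q → p :+ q :- p := q :- con 0ℚ) ≡.refl p q)

posPart-≤ : ∀ {x y} → x ≤ y → 0ℚ ⊔ (x - y) ≡ 0ℚ
posPart-≤ x≤y = p≥q⇒p⊔q≡p (x≤y⇒x-y≤0 x≤y)

posPart-≥ : ∀ {x y} → x ≤ y → 0ℚ ⊔ (y - x) ≡ y - x
posPart-≥ x≤y = p≤q⇒p⊔q≡q (x≤y⇒0≤y-x x≤y)

-- Lengths of finite unions of intervals

-- The length of what remains of the interval (s,e) after removing a list of intervals;
-- it is 0 when e ≤ s.
uncovered : ℚ → ℚ → List Pair → ℚ
uncovered s e []       = 0ℚ ⊔ (e - s)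
uncovered s e (p ∷ ps) = uncovered s (e ⊓ pq p) ps + uncovered (s ⊔ pr p) e ps

interchange : ∀ a b c d → (a + b) + (c + d) ≡ (a + c) + (b + d)
interchange = solve 4 (λ a b c d → (a :+ b) :+ (c :+ d) := (a :+ c) :+ (b :+ d)) ≡.refl

⊓-rot : ∀ a b c → (a ⊓ b) ⊓ c ≡ (a ⊓ c) ⊓ b
⊓-rot a b c = ≡.trans (⊓-assoc a b c) (≡.trans (cong (a ⊓_) (⊓-comm b c)) (sym (⊓-assoc a c b)))

⊔-rot : ∀ a b c → (a ⊔ b) ⊔ c ≡ (a ⊔ c) ⊔ b
⊔-rot a b c = ≡.trans (⊔-assoc a b c) (≡.trans (cong (a ⊔_) (⊔-comm b c)) (sym (⊔-assoc a c b)))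

-- The positive part in the base case lets `x` lie anywhere: if it falls outside the interval, one
-- of the two pieces is degenerate and counts 0. In the inductive case, cutting at `x` commutes with
-- removing `p`.
uncovered-split : ∀ s e x ps → uncovered s e ps ≡ uncovered s (e ⊓ x) ps + uncovered (s ⊔ x) e ps
uncovered-split s e x [] with ≤-total e x
... | inj₁ e≤x = begin
  0ℚ ⊔ (e - s)             ≡⟨ +-identityʳ _ ⟨
  (0ℚ ⊔ (e - s)) + 0ℚ        ≡⟨ cong₂ _+_ (cong (λ z → 0ℚ ⊔ (z - s)) (p≤q⇒p⊓q≡p e≤x))
                                        (posPart-≤ (≤-trans e≤x (p≤q⊔p s x))) ⟨
  (0ℚ ⊔ ((e ⊓ x) - s)) + (0ℚ ⊔ (e - (s ⊔ x))) ∎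
  where open ≡-Reasoning
... | inj₂ x≤e with ≤-total s x
...   | inj₁ s≤x = begin
  0ℚ ⊔ (e - s)             ≡⟨ posPart-≥ (≤-trans s≤x x≤e) ⟩
  e - s                    ≡⟨ solve 3 (λ s e x → e :- s := (x :- s) :+ (e :- x)) ≡.refl s e x ⟩
  (x - s) + (e - x)        ≡⟨ cong₂ _+_ (posPart-≥ s≤x) (posPart-≥ x≤e) ⟨
  (0ℚ ⊔ (x - s)) + (0ℚ ⊔ (e - x)) ≡⟨ cong₂ (λ y z → (0ℚ ⊔ (y - s)) + (0ℚ ⊔ (e - z))) (p≥q⇒p⊓q≡q x≤e) (p≤q⇒p⊔q≡q s≤x) ⟨
  (0ℚ ⊔ ((e ⊓ x) - s)) + (0ℚ ⊔ (e - (s ⊔ x))) ∎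
  where open ≡-Reasoning
...   | inj₂ x≤s = begin
  0ℚ ⊔ (e - s)             ≡⟨ +-identityˡ _ ⟨
  0ℚ + (0ℚ ⊔ (e - s))        ≡⟨ cong₂ _+_ (posPart-≤ (≤-trans (p⊓q≤q e x) x≤s))
                                        (cong (λ z → 0ℚ ⊔ (e - z)) (p≥q⇒p⊔q≡p x≤s)) ⟨
  (0ℚ ⊔ ((e ⊓ x) - s)) + (0ℚ ⊔ (e - (s ⊔ x))) ∎
  where open ≡-Reasoning
uncovered-split s e x (p ∷ ps) = begin
  uncovered s (e ⊓ q) ps + uncovered (s ⊔ r) e ps
    ≡⟨ cong₂ _+_ (uncovered-split s (e ⊓ q) x ps) (uncovered-split (s ⊔ r) e x ps) ⟩
  (uncovered s ((e ⊓ q) ⊓ x) ps + uncovered (s ⊔ x) (e ⊓ q) ps) +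
  (uncovered (s ⊔ r) (e ⊓ x) ps + uncovered ((s ⊔ r) ⊔ x) e ps)
    ≡⟨ cong₂ (λ y z → (uncovered s y ps + uncovered (s ⊔ x) (e ⊓ q) ps) + (uncovered (s ⊔ r) (e ⊓ x) ps + uncovered z e ps))
             (⊓-rot e q x) (⊔-rot s r x) ⟩
  (uncovered s ((e ⊓ x) ⊓ q) ps + uncovered (s ⊔ x) (e ⊓ q) ps) +
  (uncovered (s ⊔ r) (e ⊓ x) ps + uncovered ((s ⊔ x) ⊔ r) e ps)
    ≡⟨ interchange (uncovered s ((e ⊓ x) ⊓ q) ps) (uncovered (s ⊔ x) (e ⊓ q) ps)
                   (uncovered (s ⊔ r) (e ⊓ x) ps) (uncovered ((s ⊔ x) ⊔ r) e ps) ⟩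
  (uncovered s ((e ⊓ x) ⊓ q) ps + uncovered (s ⊔ r) (e ⊓ x) ps) +
  (uncovered (s ⊔ x) (e ⊓ q) ps + uncovered ((s ⊔ x) ⊔ r) e ps) ∎
  where
  open ≡-Reasoning
  q = pq p
  r = pr p

uncovered-empty : ∀ {s e} ps → e ≤ s → uncovered s e ps ≡ 0ℚ
uncovered-empty []       e≤s = posPart-≤ e≤s
uncovered-empty (p ∷ ps) e≤s = cong₂ _+_
  (uncovered-empty ps (≤-trans (p⊓q≤p _ _) e≤s))
  (uncovered-empty ps (≤-trans e≤s (p≤p⊔q _ _)))

uncovered-nonNeg : ∀ s e ps → 0ℚ ≤ uncovered s e ps
uncovered-nonNeg s e []       = p≤p⊔q 0ℚ (e - s)
uncovered-nonNeg s e (p ∷ ps) = +-mono-≤ (uncovered-nonNeg s (e ⊓ pq p) ps) (uncovered-nonNeg (s ⊔ pr p) e ps)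

-- Cutting at both endpoints of `p` gives three pieces. The outer two are what is left after
-- removing `p`, and the middle one is exactly what `p` takes away.
uncovered-∷ : ∀ s e p ps →
  uncovered s e ps ≡ uncovered s e (p ∷ ps) + uncovered (s ⊔ pq p) (e ⊓ pr p) ps
uncovered-∷ s e p ps = begin
  uncovered s e ps
    ≡⟨ uncovered-split s e q ps ⟩
  uncovered s (e ⊓ q) ps + uncovered (s ⊔ q) e ps
    ≡⟨ cong (uncovered s (e ⊓ q) ps +_) (uncovered-split (s ⊔ q) e r ps) ⟩
  uncovered s (e ⊓ q) ps + (uncovered (s ⊔ q) (e ⊓ r) ps + uncovered ((s ⊔ q) ⊔ r) e ps)
    ≡⟨ cong (λ z → uncovered s (e ⊓ q) ps + (uncovered (s ⊔ q) (e ⊓ r) ps + uncovered z e ps))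
            (≡.trans (⊔-assoc s q r) (cong (s ⊔_) (p≤q⇒p⊔q≡q (q≤r p)))) ⟩
  uncovered s (e ⊓ q) ps + (uncovered (s ⊔ q) (e ⊓ r) ps + uncovered (s ⊔ r) e ps)
    ≡⟨ solve 3 (λ a b c → a :+ (b :+ c) := (a :+ c) :+ b) ≡.refl
         (uncovered s (e ⊓ q) ps) (uncovered (s ⊔ q) (e ⊓ r) ps) (uncovered (s ⊔ r) e ps) ⟩
  (uncovered s (e ⊓ q) ps + uncovered (s ⊔ r) e ps) + uncovered (s ⊔ q) (e ⊓ r) ps ∎
  where
  open ≡-Reasoning
  q = pq p
  r = pr p

uncovered-∷-≤ : ∀ s e p ps → uncovered s e (p ∷ ps) ≤ uncovered s e ps
uncovered-∷-≤ s e p ps = subst (uncovered s e (p ∷ ps) ≤_) (sym (uncovered-∷ s e p ps))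
  (p≤p+q (uncovered-nonNeg (s ⊔ pq p) (e ⊓ pr p) ps))

uncovered-antitone : ∀ {ps qs} → ps ⊆ qs → ∀ s e → uncovered s e qs ≤ uncovered s e ps
uncovered-antitone []               s e = ≤-refl
uncovered-antitone (_∷ʳ_ {_} {qs} p ps⊆qs) s e = ≤-trans (uncovered-∷-≤ s e p qs) (uncovered-antitone ps⊆qs s e)
uncovered-antitone (≡.refl ∷ ps⊆qs) s e =
  +-mono-≤ (uncovered-antitone ps⊆qs s _) (uncovered-antitone ps⊆qs _ e)

uncovered-↭ : ∀ {ps qs} → ps ↭ qs → ∀ s e → uncovered s e ps ≡ uncovered s e qs
uncovered-↭ refl s e = ≡.refl
uncovered-↭ (prep p ps↭qs) s e = cong₂ _+_ (uncovered-↭ ps↭qs s _) (uncovered-↭ ps↭qs _ e)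
uncovered-↭ {_} {_ ∷ _ ∷ qs} (swap p p' ps↭qs) s e = ≡.trans
  (cong₂ _+_ (cong₂ _+_ (uncovered-↭ ps↭qs _ _) (uncovered-↭ ps↭qs _ _))
             (cong₂ _+_ (uncovered-↭ ps↭qs _ _) (uncovered-↭ ps↭qs _ _)))
  (≡.trans (interchange (uncovered s ((e ⊓ pq p) ⊓ pq p') qs) (uncovered (s ⊔ pr p') (e ⊓ pq p) qs)
                        (uncovered (s ⊔ pr p) (e ⊓ pq p') qs) (uncovered ((s ⊔ pr p) ⊔ pr p') e qs))
  (cong₂ (λ y z → (uncovered s y qs + uncovered (s ⊔ pr p) (e ⊓ pq p') qs) + (uncovered (s ⊔ pr p') (e ⊓ pq p) qs + uncovered z e qs))
    (⊓-rot e (pq p) (pq p')) (⊔-rot s (pr p) (pr p'))))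
uncovered-↭ (trans ps↭qs qs↭rs) s e = ≡.trans (uncovered-↭ ps↭qs s e) (uncovered-↭ qs↭rs s e)

uncovered-disjoint : ∀ {s e} → s ≤ e → ∀ {ps} → All (λ p → e ≤ pq p) ps → uncovered s e ps ≡ e - s
uncovered-disjoint s≤e []                    = posPart-≥ s≤e
uncovered-disjoint {s} {e} s≤e {p ∷ ps} (e≤q ∷ e≤ps) = begin
  uncovered s (e ⊓ pq p) ps + uncovered (s ⊔ pr p) e ps
    ≡⟨ cong₂ _+_ (cong (λ z → uncovered s z ps) (p≤q⇒p⊓q≡p e≤q))
                 (uncovered-empty ps (≤-trans e≤q (≤-trans (q≤r p) (p≤q⊔p s (pr p))))) ⟩
  uncovered s e ps + 0ℚ  ≡⟨ +-identityʳ _ ⟩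
  uncovered s e ps       ≡⟨ uncovered-disjoint s≤e e≤ps ⟩
  e - s                  ∎
  where open ≡-Reasoning

-- A new interval contributes its uncovered part. That part only shrinks when the list grows,
-- so this presentation makes the strong subadditivity of the length immediate.
coveredLength : List Pair → ℚ
coveredLength []       = 0ℚ
coveredLength (p ∷ ps) = uncovered (pq p) (pr p) ps + coveredLength ps

-- Only a swap needs an argument. By `uncovered-∷`, what either interval adds on its own is what it
-- adds after the other plus the uncovered part of their intersection, and this last term is
-- symmetric in the two.
coveredLength-↭ : ∀ {ps qs} → ps ↭ qs → coveredLength ps ≡ coveredLength qs
coveredLength-↭ refl = ≡.refl
coveredLength-↭ (prep p ps↭qs) = cong₂ _+_ (uncovered-↭ ps↭qs _ _) (coveredLength-↭ ps↭qs)
coveredLength-↭ {_ ∷ _ ∷ ps} {_ ∷ _ ∷ qs} (swap p p' ps↭qs) = begin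
  U p (p' ∷ ps) + (U p' ps + coveredLength ps)
    ≡⟨ cong₂ (λ y z → y + (U p' ps + z)) (uncovered-↭ (prep p' ps↭qs) (pq p) (pr p)) (coveredLength-↭ ps↭qs) ⟩
  U p (p' ∷ qs) + (U p' ps + coveredLength qs)
    ≡⟨ cong (λ z → U p (p' ∷ qs) + (z + coveredLength qs))
         (≡.trans (uncovered-↭ ps↭qs _ _) (uncovered-∷ (pq p') (pr p') p qs)) ⟩
  U p (p' ∷ qs) + ((U p' (p ∷ qs) + uncovered (pq p' ⊔ pq p) (pr p' ⊓ pr p) qs) + coveredLength qs)
    ≡⟨ solve 4 (λ a b c d → a :+ ((b :+ c) :+ d) := b :+ ((a :+ c) :+ d)) ≡.refl
         (U p (p' ∷ qs)) (U p' (p ∷ qs)) (uncovered (pq p' ⊔ pq p) (pr p' ⊓ pr p) qs) (coveredLength qs) ⟩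
  U p' (p ∷ qs) + ((U p (p' ∷ qs) + uncovered (pq p' ⊔ pq p) (pr p' ⊓ pr p) qs) + coveredLength qs)
    ≡⟨ cong₂ (λ y z → U p' (p ∷ qs) + ((U p (p' ∷ qs) + uncovered y z qs) + coveredLength qs))
         (⊔-comm (pq p') (pq p)) (⊓-comm (pr p') (pr p)) ⟩
  U p' (p ∷ qs) + ((U p (p' ∷ qs) + uncovered (pq p ⊔ pq p') (pr p ⊓ pr p') qs) + coveredLength qs)
    ≡⟨ cong (λ z → U p' (p ∷ qs) + (z + coveredLength qs)) (uncovered-∷ (pq p) (pr p) p' qs) ⟨
  U p' (p ∷ qs) + (U p qs + coveredLength qs) ∎
  where
  open ≡-Reasoning
  U : Pair → List Pair → ℚ
  U p ps = uncovered (pq p) (pr p) ps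
coveredLength-↭ (trans ps↭qs qs↭rs) = ≡.trans (coveredLength-↭ ps↭qs) (coveredLength-↭ qs↭rs)

-- Agreement of the sort-and-merge length with `coveredLength`

insert-↭ : ∀ p ps → insert p ps ↭ p ∷ ps
insert-↭ p [] = refl
insert-↭ p (p' ∷ ps) with pq p ≤? pq p'
... | yes _ = refl
... | no  _ = trans (prep p' (insert-↭ p ps)) (swap p' p refl)

sortPairs-↭ : ∀ ps → sortPairs ps ↭ ps
sortPairs-↭ []       = refl
sortPairs-↭ (p ∷ ps) = trans (insert-↭ p (sortPairs ps)) (prep p (sortPairs-↭ ps))

Sorted : List Pair → Set
Sorted = AllPairs (λ p p' → pq p ≤ pq p')

insert-sorted : ∀ p {ps} → Sorted ps → Sorted (insert p ps)
insert-sorted p [] = [] ∷ []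
insert-sorted p {p' ∷ ps} (p'≤ps ∷ sorted) with pq p ≤? pq p'
... | yes p≤p' = (p≤p' ∷ All.map (≤-trans p≤p') p'≤ps) ∷ p'≤ps ∷ sorted
... | no  p≰p' = All-resp-↭ (↭-sym (insert-↭ p ps)) (<⇒≤ (≰⇒> p≰p') ∷ p'≤ps) ∷ insert-sorted p sorted

sortPairs-sorted : ∀ ps → Sorted (sortPairs ps)
sortPairs-sorted []       = []
sortPairs-sorted (p ∷ ps) = insert-sorted p (sortPairs-sorted ps)

-- This is the merging step of `mergeLen`: the extended block is cut at `q` and then at `r`. The
-- piece beyond `r` agrees with `(s ⊔ r , e)`, because both are empty if `e ≤ r`, and both run from
-- `r` to `e` otherwise.
uncovered-merge : ∀ {s e q r} → s ≤ q → q ≤ e → q ≤ r → ∀ ps →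
  uncovered s (e ⊔ r) ps ≡ (uncovered s (e ⊓ q) ps + uncovered (s ⊔ r) e ps) + uncovered q r ps
uncovered-merge {s} {e} {q} {r} s≤q q≤e q≤r ps = begin
  uncovered s (e ⊔ r) ps
    ≡⟨ uncovered-split s (e ⊔ r) q ps ⟩
  uncovered s ((e ⊔ r) ⊓ q) ps + uncovered (s ⊔ q) (e ⊔ r) ps
    ≡⟨ cong₂ (λ y z → uncovered s y ps + uncovered z (e ⊔ r) ps)
         (≡.trans (p≥q⇒p⊓q≡q (≤-trans q≤e (p≤p⊔q e r))) (sym (p≥q⇒p⊓q≡q q≤e)))
         (p≤q⇒p⊔q≡q s≤q) ⟩
  uncovered s (e ⊓ q) ps + uncovered q (e ⊔ r) ps
    ≡⟨ cong (uncovered s (e ⊓ q) ps +_) (uncovered-split q (e ⊔ r) r ps) ⟩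
  uncovered s (e ⊓ q) ps + (uncovered q ((e ⊔ r) ⊓ r) ps + uncovered (q ⊔ r) (e ⊔ r) ps)
    ≡⟨ cong₂ (λ y z → uncovered s (e ⊓ q) ps + (uncovered q y ps + z))
         (p≥q⇒p⊓q≡q (p≤q⊔p e r)) rest ⟩
  uncovered s (e ⊓ q) ps + (uncovered q r ps + uncovered (s ⊔ r) e ps)
    ≡⟨ solve 3 (λ a b c → a :+ (b :+ c) := (a :+ c) :+ b) ≡.refl
         (uncovered s (e ⊓ q) ps) (uncovered q r ps) (uncovered (s ⊔ r) e ps) ⟩
  (uncovered s (e ⊓ q) ps + uncovered (s ⊔ r) e ps) + uncovered q r ps ∎
  where
  open ≡-Reasoning
  rest : uncovered (q ⊔ r) (e ⊔ r) ps ≡ uncovered (s ⊔ r) e ps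
  rest with ≤-total e r
  ... | inj₁ e≤r = ≡.trans
    (uncovered-empty ps (≤-trans (≤-reflexive (p≤q⇒p⊔q≡q e≤r)) (p≤q⊔p q r)))
    (sym (uncovered-empty ps (≤-trans e≤r (p≤q⊔p s r))))
  ... | inj₂ r≤e = cong₂ (λ y z → uncovered y z ps)
    (≡.trans (p≤q⇒p⊔q≡q q≤r) (sym (p≤q⇒p⊔q≡q (≤-trans s≤q q≤r)))) (p≥q⇒p⊔q≡p r≤e)

-- The invariant treats the current block as one more interval in front of the list. If the next
-- interval meets the block, `uncovered-merge` applies; if not, sortedness puts all later intervals
-- to the right of the block, which then counts in full.
mergeLen≡coveredLength : ∀ {s e} → s ≤ e → ∀ {ps} → All (λ p → s ≤ pq p) ps → Sorted ps →
  mergeLen s e ps ≡ uncovered s e ps + coveredLength ps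
mergeLen≡coveredLength {s} {e} s≤e [] [] =
  sym (≡.trans (+-identityʳ (0ℚ ⊔ (e - s))) (posPart-≥ s≤e))
mergeLen≡coveredLength {s} {e} s≤e {p ∷ ps} (s≤q ∷ s≤ps) (q≤ps ∷ sorted) with pq p ≤? e
... | yes q≤e = begin
  mergeLen s (e ⊔ pr p) ps
    ≡⟨ mergeLen≡coveredLength (≤-trans s≤e (p≤p⊔q e (pr p))) s≤ps sorted ⟩
  uncovered s (e ⊔ pr p) ps + coveredLength ps
    ≡⟨ cong (_+ coveredLength ps) (uncovered-merge s≤q q≤e (q≤r p) ps) ⟩
  (uncovered s e (p ∷ ps) + uncovered (pq p) (pr p) ps) + coveredLength ps
    ≡⟨ +-assoc (uncovered s e (p ∷ ps)) (uncovered (pq p) (pr p) ps) (coveredLength ps) ⟩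
  uncovered s e (p ∷ ps) + coveredLength (p ∷ ps) ∎
  where open ≡-Reasoning
... | no q≰e = cong₂ _+_
  (sym (uncovered-disjoint s≤e {p ∷ ps} (e≤q ∷ All.map (≤-trans e≤q) q≤ps)))
  (mergeLen≡coveredLength (q≤r p) {ps} q≤ps sorted)
  where e≤q = <⇒≤ (≰⇒> q≰e)

unionLen≡coveredLength : ∀ ps → unionLen ps ≡ coveredLength ps
unionLen≡coveredLength ps with sortPairs ps | sortPairs-↭ ps | sortPairs-sorted ps
... | []     | []↭ps | []              = coveredLength-↭ []↭ps
... | q ∷ qs | qs↭ps | (q≤qs ∷ sorted) =
  ≡.trans (mergeLen≡coveredLength (q≤r q) q≤qs sorted) (coveredLength-↭ qs↭ps)

-- `applyDownFrom` puts the newest interval at the head, so that passing from `n` to `suc n` unfolds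
-- `coveredLength` once. The reversal is harmless by invariance under permutation.
μfin≡coveredLength : ∀ α n → μfin α n ≡ coveredLength (applyDownFrom α n)
μfin≡coveredLength α n = ≡.trans (unionLen≡coveredLength (map α (upTo n)))
  (coveredLength-↭ (trans (↭-sym (↭-reverse (map α (upTo n))))
    (↭-reflexive (≡.trans (cong reverse (map-upTo α n)) (reverse-applyUpTo α n)))))

-- Monotone sequences, powers of two and the Archimedean property

stepwise-monotone : ∀ (f : ℕ → ℚ) → (∀ n → f n ≤ f (suc n)) → ∀ {i j} → i ℕ.≤ j → f i ≤ f j
stepwise-monotone f step i≤j = go (ℕₚ.≤⇒≤′ i≤j)
  where
  go : ∀ {i j} → i ℕ.≤′ j → f i ≤ f j
  go (ℕ.≤′-reflexive ≡.refl) = ≤-refl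
  go (ℕ.≤′-step i≤j)         = ≤-trans (go i≤j) (step _)

stepwise-antitone : ∀ (f : ℕ → ℚ) → (∀ n → f (suc n) ≤ f n) → ∀ {i j} → i ℕ.≤ j → f j ≤ f i
stepwise-antitone f step i≤j =
  neg-cancel (stepwise-monotone (λ n → - f n) (λ n → neg-antimono-≤ (step n)) i≤j)
  where
  neg-cancel : ∀ {p q} → - p ≤ - q → q ≤ p
  neg-cancel {p} {q} -p≤-q = ≤-fromDifference -p≤-q
    (solve 2 (λ p q → p :- q := :- q :- (:- p)) ≡.refl p q)

pow2inv>0 : ∀ m → 0ℚ < pow2inv m
pow2inv>0 m = positive⁻¹ (pow2inv m) {{pow2inv-pos m}}

pow2inv-double : ∀ m → pow2inv (suc m) + pow2inv (suc m) ≡ pow2inv m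
pow2inv-double m = solve 1 (λ p → con ½ :* p :+ con ½ :* p := p) ≡.refl (pow2inv m)

p<p+q : ∀ {p q} → 0ℚ < q → p < p + q
p<p+q {p} {q} 0<q = <-fromDifference 0<q
  (solve 2 (λ p q → p :+ q :- p := q :- con 0ℚ) ≡.refl p q)

pow2inv-suc< : ∀ m → pow2inv (suc m) < pow2inv m
pow2inv-suc< m = subst (pow2inv (suc m) <_) (pow2inv-double m) (p<p+q (pow2inv>0 (suc m)))

pow2inv-antitone : ∀ {i j} → i ℕ.≤ j → pow2inv j ≤ pow2inv i
pow2inv-antitone = stepwise-antitone pow2inv (λ m → <⇒≤ (pow2inv-suc< m))

pow2inv-antitone-< : ∀ {i j} → i ℕ.< j → pow2inv j < pow2inv i
pow2inv-antitone-< {i} i<j = ≤-<-trans (pow2inv-antitone i<j) (pow2inv-suc< i)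

ℕtoℚ-suc : ∀ n → ℕtoℚ (suc n) ≡ 1ℚ + ℕtoℚ n
ℕtoℚ-suc n = toℚᵘ-injective (begin
  toℚᵘ (ℕtoℚ (suc n))                ≈⟨ toℚᵘ-fromℚᵘ (ℚᵘ.mkℚᵘ (ℤ.+ suc n) 0) ⟩
  ℚᵘ.mkℚᵘ (ℤ.+ suc n) 0              ≡⟨ cong (λ z → ℚᵘ.mkℚᵘ (ℤ.1ℤ ℤ.+ z) 0) (ℤₚ.*-identityʳ (ℤ.+ n)) ⟨
  ℚᵘ.1ℚᵘ ℚᵘ.+ ℚᵘ.mkℚᵘ (ℤ.+ n) 0      ≈⟨ ℚᵘₚ.+-congʳ ℚᵘ.1ℚᵘ (toℚᵘ-fromℚᵘ (ℚᵘ.mkℚᵘ (ℤ.+ n) 0)) ⟨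
  ℚᵘ.1ℚᵘ ℚᵘ.+ toℚᵘ (ℕtoℚ n)          ≈⟨ toℚᵘ-homo-+ 1ℚ (ℕtoℚ n) ⟨
  toℚᵘ (1ℚ + ℕtoℚ n)                 ∎)
  where open import Relation.Binary.Reasoning.Setoid ℚᵘₚ.≃-setoid

-- This is `n + 1 ≤ 2^n`, divided by `2^n`.
ℕtoℚ-*-pow2inv : ∀ n → ℕtoℚ n * pow2inv n + pow2inv n ≤ 1ℚ
ℕtoℚ-*-pow2inv zero    = ≤-refl
ℕtoℚ-*-pow2inv (suc n) = begin
  ℕtoℚ (suc n) * (½ * p) + ½ * p   ≡⟨ cong (λ k → k * (½ * p) + ½ * p) (ℕtoℚ-suc n) ⟩
  (1ℚ + N) * (½ * p) + ½ * p       ≡⟨ solve 2 (λ N p → (con 1ℚ :+ N) :* (con ½ :* p) :+ con ½ :* p := con ½ :* (N :* p :+ p) :+ con ½ :* p) ≡.refl N p ⟩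
  ½ * (N * p + p) + ½ * p          ≤⟨ +-mono-≤ (*-monoˡ-≤-nonNeg ½ (ℕtoℚ-*-pow2inv n)) (*-monoˡ-≤-nonNeg ½ (pow2inv-antitone (ℕ.z≤n {n}))) ⟩
  1ℚ                               ∎
  where
  open ≤-Reasoning
  N = ℕtoℚ n
  p = pow2inv n

-- The product is the numerator of `q`, which is a positive integer.
1≤denominator*q : ∀ {q} → 0ℚ < q → 1ℚ ≤ ℕtoℚ (↧ₙ q) * q
1≤denominator*q {q@(mkℚ (ℤ.+ suc k) d _)} 0<q = toℚᵘ-cancel-≤ (begin
  ℚᵘ.1ℚᵘ                                           ≤⟨ ℚᵘ.*≤* (ℤ.+≤+ le) ⟩
  ℚᵘ.mkℚᵘ (ℤ.+ suc d) 0 ℚᵘ.* toℚᵘ q                ≃⟨ ℚᵘₚ.*-congʳ {toℚᵘ q} (toℚᵘ-fromℚᵘ (ℚᵘ.mkℚᵘ (ℤ.+ suc d) 0)) ⟨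
  toℚᵘ (ℕtoℚ (suc d)) ℚᵘ.* toℚᵘ q                  ≃⟨ toℚᵘ-homo-* (ℕtoℚ (suc d)) q ⟨
  toℚᵘ (ℕtoℚ (suc d) * q)                          ∎)
  where
  open ℚᵘₚ.≤-Reasoning
  le : 1 ℕ.* suc (d ℕ.+ 0) ℕ.≤ suc d ℕ.* suc k ℕ.* 1
  le = ℕₚ.≤-trans (ℕₚ.≤-reflexive (≡.trans (ℕₚ.*-identityˡ _) (cong suc (ℕₚ.+-identityʳ d))))
    (ℕₚ.≤-trans (ℕₚ.m≤m*n (suc d) (suc k)) (ℕₚ.≤-reflexive (sym (ℕₚ.*-identityʳ _))))
1≤denominator*q {mkℚ (ℤ.+ zero) _ _} (*<* (ℤ.+<+ ()))
1≤denominator*q {mkℚ (ℤ.-[1+ _ ]) _ _} (*<* ())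

*-cancel-1 : ∀ {n p q} → .{{NonNegative n}} → 0ℚ < p → n * p + p ≤ 1ℚ → 1ℚ ≤ n * q → p < q
*-cancel-1 {n} {p} {q} 0<p np+p≤1 1≤nq with p <? q
... | yes p<q = p<q
... | no  p≮q = contradiction (begin-strict
  1ℚ           <⟨ p<p+q 0<p ⟩
  1ℚ + p       ≤⟨ +-monoˡ-≤ p 1≤nq ⟩
  n * q + p    ≤⟨ +-monoˡ-≤ p (*-monoˡ-≤-nonNeg n (≮⇒≥ p≮q)) ⟩
  n * p + p    ≤⟨ np+p≤1 ⟩
  1ℚ           ∎) (<-irrefl ≡.refl)
  where open ≤-Reasoning

-- The denominator `d` of `q` serves as exponent: `2^-d ≤ 1/(d+1) < 1/d ≤ q`.
archimedean : ∀ {q} → 0ℚ < q → Σ ℕ λ m → pow2inv m < q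
archimedean {q} 0<q = ↧ₙ q , *-cancel-1 {n = ℕtoℚ (↧ₙ q)} {{normalize-nonNeg (↧ₙ q) 1}}
  (pow2inv>0 (↧ₙ q)) (ℕtoℚ-*-pow2inv (↧ₙ q)) (1≤denominator*q 0<q)

x<y⇒0<y-x : ∀ {x y} → x < y → 0ℚ < y - x
x<y⇒0<y-x {x} {y} x<y = <-fromDifference x<y (solve 2 (λ x y → y :- x :- con 0ℚ := y :- x) ≡.refl x y)

x-[y+z] : ∀ x y z → x - (y + z) ≡ (x - y) - z
x-[y+z] = solve 3 (λ x y z → x :- (y :+ z) := (x :- y) :- z) ≡.refl

x+y-z : ∀ x y z → x + y - z ≡ x - (z - y)
x+y-z = solve 3 (λ x y z → x :+ y :- z := x :- (z :- y)) ≡.refl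

x-y+y : ∀ x y → (x - y) + y ≡ x
x-y+y = solve 2 (λ x y → (x :- y) :+ y := x) ≡.refl

x+y-x : ∀ x y → x + y - x ≡ y
x+y-x = solve 2 (λ x y → x :+ y :- x := y) ≡.refl

cotransitivity-identity : ∀ a b l h → b - h ≡ (a + (b - a)) - (l + (h - l))
cotransitivity-identity = solve 4 (λ a b l h → b :- h := (a :+ (b :- a)) :- (l :+ (h :- l))) ≡.refl

pow2inv-between : ∀ {x y} → x < y → Σ ℕ λ m → x + pow2inv m < y
pow2inv-between {x} {y} x<y =
  let m , p<y-x = archimedean (x<y⇒0<y-x x<y)
  in m , <-fromDifference p<y-x (x-[y+z] y x (pow2inv m))

≤-fromSlack : ∀ {x y} → (∀ m → x < y + pow2inv m) → x ≤ y
≤-fromSlack {x} {y} x<y+ with x ≤? y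
... | yes x≤y = x≤y
... | no  x≰y =
  let m , y+p<x = pow2inv-between (≰⇒> x≰y)
  in contradiction (x<y+ m) (<-asym y+p<x)

-- Comparison of reals with rationals

lo≤hi-any : ∀ x i j → lo x i ≤ hi x j
lo≤hi-any x i j = begin
  lo x i            ≤⟨ stepwise-monotone (lo x) (lo-mono x) (ℕₚ.m≤m⊔n i j) ⟩
  lo x (i ℕ.⊔ j)    ≤⟨ lo≤hi x (i ℕ.⊔ j) ⟩
  hi x (i ℕ.⊔ j)    ≤⟨ stepwise-antitone (hi x) (hi-mono x) (ℕₚ.m≤n⊔m i j) ⟩
  hi x j            ∎
  where open ≤-Reasoning

emb<⇒<-emb : ∀ {a b} x → emb a <ℝ x → x <ℝ emb b → a < b
emb<⇒<-emb x (i , a<lo) (j , hi<b) = <-trans (<-≤-trans a<lo (lo≤hi-any x i j)) hi<b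

-- Abstract because case distinctions on it would otherwise unfold the arithmetic of symbolic
-- rationals, which is prohibitively slow.
abstract
  emb-cotransitive : ∀ {a b} x → a < b → (emb a <ℝ x) ⊎ (x <ℝ emb b)
  emb-cotransitive {a} {b} x a<b = compare (proj₁ short) (proj₂ short)
    where
    short : Σ ℕ λ n → hi x n - lo x n < b - a
    short = let m , p<b-a = archimedean (x<y⇒0<y-x a<b)
                n , w<p   = dwindle x m
            in n , <-trans w<p p<b-a
    compare : ∀ n → hi x n - lo x n < b - a → (emb a <ℝ x) ⊎ (x <ℝ emb b)
    compare n w<b-a with a <? lo x n
    ... | yes a<lo = inj₁ (n , a<lo)
    ... | no  a≮lo = inj₂ (n , <-fromDifference (+-mono-≤-< (≮⇒≥ a≮lo) w<b-a)
                                 (cotransitivity-identity a b (lo x n) (hi x n)))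

-- Measurability of sequences of intervals

-- For monotone `s` this amounts to having a real limit below `ε`, as the next module shows in both
-- directions. It mentions rationals only, so that adding and comparing sequences requires no
-- arithmetic of reals.
record ConvergesBelow (s : ℕ → ℚ) (ε : ℚ) : Set where
  field
    bound   : ℚ
    bound<ε : bound < ε
    s≤bound : ∀ k → s k ≤ bound
    modulus : ∀ m → Σ ℕ λ N → ∀ k → s k < s N + pow2inv m
open ConvergesBelow

Monotone : (ℕ → ℚ) → Set
Monotone s = ∀ n → s n ≤ s (suc n)

module _ (s : ℕ → ℚ) (s-mono : Monotone s) where

  private
    s-≤ : ∀ {i j} → i ℕ.≤ j → s i ≤ s j
    s-≤ = stepwise-monotone s s-mono

  limit⇒convergesBelow : ∀ {L ε} → IsLimit s L → L <ℝ emb ε → ConvergesBelow s ε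
  limit⇒convergesBelow {L} {ε} s→L (n₀ , hiL<ε) = record
    -- The index that witnesses `L <ℝ emb ε` provides a rational upper estimate of `L` strictly
    -- below `ε`.
    { bound   = hi L n₀
    ; bound<ε = hiL<ε
    ; s≤bound = λ k → ≤-fromSlack λ m →
        let N , close = s→L m
            i , below = proj₁ (close (N ℕ.⊔ k) (ℕₚ.m≤m⊔n N k))
            open ≤-Reasoning
        in <-fromDifference
          (begin-strict
            s k - pow2inv m           ≤⟨ +-monoˡ-≤ (- pow2inv m) (s-≤ (ℕₚ.m≤n⊔m N k)) ⟩
            s (N ℕ.⊔ k) - pow2inv m   <⟨ below ⟩
            lo L i                    ≤⟨ lo≤hi-any L i n₀ ⟩
            hi L n₀                   ∎)
          (x+y-z (hi L n₀) (pow2inv m) (s k))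
    ; modulus = λ m →
        let N , close = s→L (suc m)
        in N , λ k →
          let i , below = proj₁ (close (N ℕ.⊔ k) (ℕₚ.m≤m⊔n N k))
              j , above = proj₂ (close N ℕₚ.≤-refl)
              p = pow2inv (suc m)
              open ≤-Reasoning
          in begin-strict
            s k                         ≤⟨ s-≤ (ℕₚ.m≤n⊔m N k) ⟩
            s (N ℕ.⊔ k)                 ≡⟨ x-y+y (s (N ℕ.⊔ k)) p ⟨
            (s (N ℕ.⊔ k) - p) + p       <⟨ +-monoˡ-< p below ⟩
            lo L i + p                  ≤⟨ +-monoˡ-≤ p (lo≤hi-any L i j) ⟩
            hi L j + p                  <⟨ +-monoˡ-< p above ⟩
            (s N + p) + p               ≡⟨ +-assoc (s N) p p ⟩
            s N + (p + p)               ≡⟨ cong (s N +_) (pow2inv-double m) ⟩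
            s N + pow2inv m             ∎
    }

  module _ {ε} (c : ConvergesBelow s ε) where

    private
      -- A running maximum of the moduli, so that `s` is nondecreasing along it.
      index : ℕ → ℕ
      index zero    = proj₁ (modulus c 0)
      index (suc n) = index n ℕ.⊔ proj₁ (modulus c (suc n))

      s-index : ∀ n k → s k < s (index n) + pow2inv n
      s-index zero    k = proj₂ (modulus c 0) k
      s-index (suc n) k = <-≤-trans (proj₂ (modulus c (suc n)) k)
        (+-monoˡ-≤ (pow2inv (suc n)) (s-≤ (ℕₚ.m≤n⊔m (index n) _)))

      hi-step : ∀ n → s (index (suc (suc n))) + pow2inv (suc n) ≤ s (index (suc n)) + pow2inv n
      hi-step n = begin
        s (index (suc (suc n))) + p   ≤⟨ +-monoˡ-≤ p (<⇒≤ (s-index (suc n) (index (suc (suc n))))) ⟩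
        (a + p) + p                   ≡⟨ +-assoc a p p ⟩
        a + (p + p)                   ≡⟨ cong (a +_) (pow2inv-double n) ⟩
        a + pow2inv n                 ∎
        where
        open ≤-Reasoning
        p = pow2inv (suc n)
        a = s (index (suc n))

    limit : ℝ
    limit = record
      -- The index runs one ahead: it guarantees the error `2^-(n+1)`, whereas `hi` allows `2^-n`.
      -- This factor two makes the upper ends decrease (`hi-step`) and yields the strict
      -- inequalities of `limit-isLimit`.
      { lo = λ n → s (index (suc n))
      ; hi = λ n → s (index (suc n)) + pow2inv n
      ; lo≤hi = λ n → <⇒≤ (p<p+q (pow2inv>0 n))
      ; lo-mono = λ n → s-≤ (ℕₚ.m≤m⊔n (index (suc n)) _)
      ; hi-mono = hi-step
      ; dwindle = λ m → suc m , subst (_< pow2inv m)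
          (sym (x+y-x (s (index (suc (suc m)))) (pow2inv (suc m))))
          (pow2inv-suc< m)
      }

    limit-isLimit : IsLimit s limit
    limit-isLimit m = index (suc (suc m)) , λ k N≤k →
      (m , <-fromDifference (<-trans (s-index (suc m) k) (+-monoʳ-< (s (index (suc m))) (pow2inv-suc< m)))
        (sym (x+y-z (s (index (suc m))) (pow2inv m) (s k)))) ,
      (suc m , +-mono-≤-< (s-≤ N≤k) (pow2inv-suc< m))

    limit<ε : limit <ℝ emb ε
    limit<ε =
      let m , b+p<ε = pow2inv-between (bound<ε c)
      in m , ≤-<-trans (+-monoˡ-≤ (pow2inv m) (s≤bound c (index (suc m)))) b+p<ε

covered : (ℕ → Pair) → ℕ → ℚ
covered α n = coveredLength (applyDownFrom α n)

covered-mono : ∀ α → Monotone (covered α)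
covered-mono α n = subst (covered α n ≤_) (+-comm (covered α n) _)
  (p≤p+q (uncovered-nonNeg (pq (α n)) (pr (α n)) (applyDownFrom α n)))

isLimit-cong : ∀ {s t L} → (∀ k → s k ≡ t k) → IsLimit s L → IsLimit t L
isLimit-cong {s} {t} {L} s≡t s→L m =
  let N , near = s→L m
  in N , λ k N≤k → subst Near (s≡t k) (near k N≤k)
  where
  Near : ℚ → Set
  Near q = (emb (q - pow2inv m) <ℝ L) × (L <ℝ emb (q + pow2inv m))

measurableBelow⇒convergesBelow : ∀ {α ε} → MeasurableBelow α ε → ConvergesBelow (covered α) ε
measurableBelow⇒convergesBelow {α} (L , μ→L , L<ε) =
  limit⇒convergesBelow (covered α) (covered-mono α) {L} (isLimit-cong {μfin α} {covered α} {L} (μfin≡coveredLength α) μ→L) L<ε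

convergesBelow⇒measurableBelow : ∀ {α ε} → ConvergesBelow (covered α) ε → MeasurableBelow α ε
convergesBelow⇒measurableBelow {α} c =
  limit s mono c ,
  isLimit-cong {s} {μfin α} {limit s mono c} (λ k → sym (μfin≡coveredLength α k)) (limit-isLimit s mono c) ,
  limit<ε s mono c
  where
  s = covered α
  mono = covered-mono α

swap-right : ∀ x y z → (x + y) + z ≡ (x + z) + y
swap-right = solve 3 (λ x y z → (x :+ y) :+ z := (x :+ z) :+ y) ≡.refl

convergesBelow-+ : ∀ {s t ε δ} → Monotone s → Monotone t →
  ConvergesBelow s ε → ConvergesBelow t δ → ConvergesBelow (λ n → s n + t n) (ε + δ)
convergesBelow-+ {s} {t} s-mono t-mono c d = record
  { bound   = bound c + bound d
  ; bound<ε = +-mono-< (bound<ε c) (bound<ε d)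
  ; s≤bound = λ k → +-mono-≤ (s≤bound c k) (s≤bound d k)
  ; modulus = λ m →
      let M , s<  = modulus c (suc m)
          N , t<  = modulus d (suc m)
          K       = M ℕ.⊔ N
          p       = pow2inv (suc m)
          open ≤-Reasoning
      in K , λ k → begin-strict
        s k + t k                  <⟨ +-mono-< (s< k) (t< k) ⟩
        (s M + p) + (t N + p)      ≡⟨ interchange (s M) p (t N) p ⟩
        (s M + t N) + (p + p)      ≤⟨ +-mono-≤ (+-mono-≤ (stepwise-monotone s s-mono (ℕₚ.m≤m⊔n M N)) (stepwise-monotone t t-mono (ℕₚ.m≤n⊔m M N)))
                                       (≤-reflexive (pow2inv-double m)) ⟩
        (s K + t K) + pow2inv m    ∎
  }

convergesBelow-translate : ∀ {s ε} q → ConvergesBelow s ε → ConvergesBelow (λ n → s n + q) (ε + q)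
convergesBelow-translate {s} q c = record
  { bound   = bound c + q
  ; bound<ε = +-monoˡ-< q (bound<ε c)
  ; s≤bound = λ k → +-monoˡ-≤ q (s≤bound c k)
  ; modulus = λ m →
      let N , s< = modulus c m
      in N , λ k → <-≤-trans (+-monoˡ-< q (s< k)) (≤-reflexive (swap-right (s N) (pow2inv m) q))
  }

convergesBelow-weaken : ∀ {s ε δ} → ε ≤ δ → ConvergesBelow s ε → ConvergesBelow s δ
convergesBelow-weaken ε≤δ c = record
  { bound   = bound c
  ; bound<ε = <-≤-trans (bound<ε c) ε≤δ
  ; s≤bound = s≤bound c
  ; modulus = modulus c
  }

-- By the assumption on steps, `t n - s (g n)` never decreases. So beyond `N` the sequence `s` along
-- `g` grows no more than `t` does, and the modulus of `t` passes to `s` through `g`. A mere bound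
-- of `s` by `t` would not give a modulus. The map `g` allows several entries of the combined
-- covering for one step of `t`.
convergesBelow-dominated : ∀ {s t ε} (g : ℕ → ℕ) → (∀ n → n ℕ.≤ g n) → Monotone s →
  s (g 0) ≤ t 0 → (∀ n → s (g (suc n)) + t n ≤ s (g n) + t (suc n)) →
  Monotone t → ConvergesBelow t ε → ConvergesBelow s ε
convergesBelow-dominated {s} {t} g n≤g s-mono s₀≤t₀ step t-mono c = record
  { bound   = bound c
  ; bound<ε = bound<ε c
  ; s≤bound = λ k → ≤-trans (s≤sg k) (≤-trans (s∘g≤t k) (s≤bound c k))
  ; modulus = λ m →
      let N , t< = modulus c m
      in g N , λ k → ≤-<-trans (s-≤ (ℕₚ.m≤n⊔m N k)) (≤-<-trans (s≤sg (N ℕ.⊔ k))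
           (<-fromDifference (+-mono-≤-< (gap (ℕₚ.m≤m⊔n N k)) (t< (N ℕ.⊔ k)))
             (modulus-identity (s (g N)) (s (g (N ℕ.⊔ k))) (t N) (t (N ℕ.⊔ k)) (pow2inv m))))
  }
  where
  modulus-identity : ∀ a b c d p → (a + p) - b ≡ ((d - b) + (c + p)) - ((c - a) + d)
  modulus-identity = solve 5 (λ a b c d p → (a :+ p) :- b := ((d :- b) :+ (c :+ p)) :- ((c :- a) :+ d)) ≡.refl

  step-identity : ∀ a b c d → (d - b) - (c - a) ≡ (a + d) - (b + c)
  step-identity = solve 4 (λ a b c d → (d :- b) :- (c :- a) := (a :+ d) :- (b :+ c)) ≡.refl

  s-≤ : ∀ {i j} → i ℕ.≤ j → s i ≤ s j
  s-≤ = stepwise-monotone s s-mono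

  gap : ∀ {i j} → i ℕ.≤ j → t i - s (g i) ≤ t j - s (g j)
  gap = stepwise-monotone (λ n → t n - s (g n)) (λ n → ≤-fromDifference (step n)
    (step-identity (s (g n)) (s (g (suc n))) (t n) (t (suc n))))

  s≤sg : ∀ k → s k ≤ s (g k)
  s≤sg k = s-≤ (n≤g k)

  x-y-0 : ∀ x y → x - y ≡ (x - y) - 0ℚ
  x-y-0 = solve 2 (λ x y → x :- y := (x :- y) :- con 0ℚ) ≡.refl

  s∘g≤t : ∀ k → s (g k) ≤ t k
  s∘g≤t k = ≤-fromDifference (≤-trans (x≤y⇒0≤y-x s₀≤t₀) (gap ℕ.z≤n)) (x-y-0 (t k) (s (g k)))

-- Interleaving two coverings and prefixing finitely many intervals

InInterval : ℝ → Pair → Set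
InInterval x p = (emb (pq p) <ℝ x) × (x <ℝ emb (pr p))

interleave : (ℕ → Pair) → (ℕ → Pair) → ℕ → Pair
interleave α β zero          = α zero
interleave α β (suc zero)    = β zero
interleave α β (suc (suc n)) = interleave (λ k → α (suc k)) (λ k → β (suc k)) n

-- The index is `n * 2` and not `2 * n` because `suc n * 2` reduces to `suc (suc (n * 2))`, which
-- matches the recursion of `interleave`.
interleave-even : ∀ α β n → interleave α β (n ℕ.* 2) ≡ α n
interleave-even α β zero    = ≡.refl
interleave-even α β (suc n) = interleave-even (λ k → α (suc k)) (λ k → β (suc k)) n

interleave-odd : ∀ α β n → interleave α β (suc (n ℕ.* 2)) ≡ β n
interleave-odd α β zero    = ≡.refl
interleave-odd α β (suc n) = interleave-odd (λ k → α (suc k)) (λ k → β (suc k)) n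

module _ (α β : ℕ → Pair) where

  private
    even-prefix : ℕ → List Pair
    even-prefix n = applyDownFrom (interleave α β) (n ℕ.* 2)

    even-prefix-suc : ∀ n → even-prefix (suc n) ≡ β n ∷ α n ∷ even-prefix n
    even-prefix-suc n = cong₂ (λ p q → p ∷ q ∷ even-prefix n) (interleave-odd α β n) (interleave-even α β n)

    left⊆ : ∀ n → applyDownFrom α n ⊆ even-prefix n
    left⊆ zero    = []
    left⊆ (suc n) = subst (applyDownFrom α (suc n) ⊆_) (sym (even-prefix-suc n)) (β n ∷ʳ ≡.refl ∷ left⊆ n)

    right⊆ : ∀ n → applyDownFrom β n ⊆ even-prefix n
    right⊆ zero    = []
    right⊆ (suc n) = subst (applyDownFrom β (suc n) ⊆_) (sym (even-prefix-suc n)) (≡.refl ∷ α n ∷ʳ right⊆ n)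

    step-identity : ∀ a b A B T → (b + (a + T)) + (A + B) ≡ T + ((a + A) + (b + B))
    step-identity = solve 5 (λ a b A B T → (b :+ (a :+ T)) :+ (A :+ B) := T :+ ((a :+ A) :+ (b :+ B))) ≡.refl

    -- Strong subadditivity: an interval adds at most as much to the interleaved prefix as to the
    -- prefix of its own sequence, since the former contains the latter (`uncovered-antitone`).
    step : ∀ n → covered (interleave α β) (suc n ℕ.* 2) + (covered α n + covered β n) ≤
                 covered (interleave α β) (n ℕ.* 2) + (covered α (suc n) + covered β (suc n))
    step n = begin
      coveredLength (even-prefix (suc n)) + (A + B)
        ≡⟨ cong (λ ps → coveredLength ps + (A + B)) (even-prefix-suc n) ⟩
      (uncovered (pq (β n)) (pr (β n)) (α n ∷ even-prefix n) + (uncovered (pq (α n)) (pr (α n)) (even-prefix n) + T)) + (A + B)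
        ≤⟨ +-monoˡ-≤ (A + B) (+-mono-≤ (uncovered-antitone (α n ∷ʳ right⊆ n) (pq (β n)) (pr (β n)))
                             (+-monoˡ-≤ T (uncovered-antitone (left⊆ n) (pq (α n)) (pr (α n))))) ⟩
      (b + (a + T)) + (A + B)
        ≡⟨ step-identity a b A B T ⟩
      T + ((a + A) + (b + B)) ∎
      where
      open ≤-Reasoning
      A = covered α n
      B = covered β n
      T = covered (interleave α β) (n ℕ.* 2)
      a = uncovered (pq (α n)) (pr (α n)) (applyDownFrom α n)
      b = uncovered (pq (β n)) (pr (β n)) (applyDownFrom β n)

  convergesBelow-interleave : ∀ {ε δ} → ConvergesBelow (covered α) ε → ConvergesBelow (covered β) δ →
    ConvergesBelow (covered (interleave α β)) (ε + δ)
  convergesBelow-interleave c d = convergesBelow-dominated {t = λ n → covered α n + covered β n}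
    (ℕ._* 2) (λ n → ℕₚ.m≤m*n n 2) (covered-mono (interleave α β))
    ≤-refl step (λ n → +-mono-≤ (covered-mono α n) (covered-mono β n))
    (convergesBelow-+ (covered-mono α) (covered-mono β) c d)

  ∉-interleaveˡ : ∀ {x} → ¬ InH (interleave α β) x → ¬ InH α x
  ∉-interleaveˡ {x} x∉ (n , x∈) = x∉ (n ℕ.* 2 ,
    subst (InInterval x) (sym (interleave-even α β n)) x∈)

  ∉-interleaveʳ : ∀ {x} → ¬ InH (interleave α β) x → ¬ InH β x
  ∉-interleaveʳ {x} x∉ (n , x∈) = x∉ (suc (n ℕ.* 2) ,
    subst (InInterval x) (sym (interleave-odd α β n)) x∈)

infixr 5 _∷ˢ_ _++ˢ_

_∷ˢ_ : Pair → (ℕ → Pair) → ℕ → Pair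
(p ∷ˢ α) zero    = p
(p ∷ˢ α) (suc n) = α n

_++ˢ_ : List Pair → (ℕ → Pair) → ℕ → Pair
[]       ++ˢ α = α
(p ∷ ps) ++ˢ α = p ∷ˢ (ps ++ˢ α)

width : Pair → ℚ
width p = pr p - pq p

totalWidth : List Pair → ℚ
totalWidth []       = 0ℚ
totalWidth (p ∷ ps) = width p + totalWidth ps

-- The interval `p` is charged its full width at the start; after that each `α n` adds at most what
-- it adds without `p`. The shift by one is the map `suc`.
convergesBelow-∷ˢ : ∀ {α ε} p → ConvergesBelow (covered α) ε → ConvergesBelow (covered (p ∷ˢ α)) (ε + width p)
convergesBelow-∷ˢ {α} {ε} p c = convergesBelow-dominated {t = λ n → covered α n + width p}
  suc ℕₚ.n≤1+n (covered-mono (p ∷ˢ α)) (≤-reflexive start) step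
  (λ n → +-monoˡ-≤ (width p) (covered-mono α n)) (convergesBelow-translate (width p) c)
  where
  start : (0ℚ ⊔ width p) + 0ℚ ≡ 0ℚ + width p
  start = ≡.trans (cong (_+ 0ℚ) (posPart-≥ (q≤r p))) (+-comm (width p) 0ℚ)

  tail⊆ : ∀ n → applyDownFrom α n ⊆ applyDownFrom (p ∷ˢ α) (suc n)
  tail⊆ zero    = p ∷ʳ []
  tail⊆ (suc n) = ≡.refl ∷ tail⊆ n

  step-identity : ∀ a A T w → (a + T) + (A + w) ≡ T + ((a + A) + w)
  step-identity = solve 4 (λ a A T w → (a :+ T) :+ (A :+ w) := T :+ ((a :+ A) :+ w)) ≡.refl

  step : ∀ n → covered (p ∷ˢ α) (suc (suc n)) + (covered α n + width p) ≤
               covered (p ∷ˢ α) (suc n) + (covered α (suc n) + width p)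
  step n = begin
    (uncovered (pq (α n)) (pr (α n)) (applyDownFrom (p ∷ˢ α) (suc n)) + T) + (A + width p)
      ≤⟨ +-monoˡ-≤ (A + width p) (+-monoˡ-≤ T (uncovered-antitone (tail⊆ n) (pq (α n)) (pr (α n)))) ⟩
    (a + T) + (A + width p)     ≡⟨ step-identity a A T (width p) ⟩
    T + ((a + A) + width p)     ∎
    where
    open ≤-Reasoning
    A = covered α n
    T = covered (p ∷ˢ α) (suc n)
    a = uncovered (pq (α n)) (pr (α n)) (applyDownFrom α n)

convergesBelow-++ˢ : ∀ {α ε} ps → ConvergesBelow (covered α) ε →
  ConvergesBelow (covered (ps ++ˢ α)) (ε + totalWidth ps)
convergesBelow-++ˢ {α} {ε} []       c = subst (ConvergesBelow (covered α)) (sym (+-identityʳ ε)) c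
convergesBelow-++ˢ {α} {ε} (p ∷ ps) c = subst (ConvergesBelow (covered (p ∷ˢ ps ++ˢ α)))
  (≡.trans (+-assoc ε (totalWidth ps) (width p)) (cong (ε +_) (+-comm (totalWidth ps) (width p))))
  (convergesBelow-∷ˢ p (convergesBelow-++ˢ ps c))

∉-++ˢˡ : ∀ {α x} ps → ¬ InH (ps ++ˢ α) x → All (λ p → ¬ InInterval x p) ps
∉-++ˢˡ []       x∉ = []
∉-++ˢˡ {α} {x} (p ∷ ps) x∉ = (λ x∈p → x∉ (0 , x∈p)) ∷ ∉-++ˢˡ {α} {x} ps λ (n , x∈) → x∉ (suc n , x∈)

∉-++ˢʳ : ∀ {α x} ps → ¬ InH (ps ++ˢ α) x → ¬ InH α x
∉-++ˢʳ []       x∉ = x∉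
∉-++ˢʳ {α} {x} (p ∷ ps) x∉ = ∉-++ˢʳ {α} {x} ps λ (n , x∈) → x∉ (suc n , x∈)

-- Windows that few dyadic values meet

totalWidth₂ : List (ℚ × Pair) → ℚ
totalWidth₂ ws = totalWidth (map proj₂ ws)

totalWidth-filter : ∀ {P : Pred (ℚ × Pair) 0ℓ} (P? : Decidable P) ws →
  totalWidth₂ (filter P? ws) + totalWidth₂ (filter (λ w → ¬? (P? w)) ws) ≡ totalWidth₂ ws
totalWidth-filter P? [] = ≡.refl
totalWidth-filter P? (w ∷ ws) with P? w
... | yes _ = ≡.trans (+-assoc (width (proj₂ w)) (totalWidth₂ (filter P? ws)) (totalWidth₂ (filter (λ w → ¬? (P? w)) ws)))
                      (cong (width (proj₂ w) +_) (totalWidth-filter P? ws))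
... | no  _ = ≡.trans (pull-left (totalWidth₂ (filter P? ws)) (width (proj₂ w)) (totalWidth₂ (filter (λ w → ¬? (P? w)) ws)))
                      (cong (width (proj₂ w) +_) (totalWidth-filter P? ws))
  where
  pull-left : ∀ x y z → x + (y + z) ≡ y + (x + z)
  pull-left = solve 3 (λ x y z → x :+ (y :+ z) := y :+ (x :+ z)) ≡.refl

-- A pair (u , p) stands for a value u taken on p; the window is [start, start + δ).
record LightWindow (ws : List (ℚ × Pair)) (a b δ κ : ℚ) : Set where
  field
    start    : ℚ
    heavy    : List (ℚ × Pair)
    a≤start  : a ≤ start
    end≤b    : start + δ ≤ b
    heavy≤κ  : totalWidth₂ heavy ≤ κ
    classify : ∀ {w} → w ∈ ws → proj₁ w < start ⊎ start + δ ≤ proj₁ w ⊎ w ∈ heavy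

≤-half : ∀ {x y z} → x + y ≡ z → x ≤ y → x ≤ ½ * z
≤-half {x} {y} {z} x+y≡z x≤y = begin
  x                ≡⟨ halves x ⟩
  ½ * (x + x)      ≤⟨ *-monoˡ-≤-nonNeg ½ (+-monoʳ-≤ x x≤y) ⟩
  ½ * (x + y)      ≡⟨ cong (½ *_) x+y≡z ⟩
  ½ * z            ∎
  where
  open ≤-Reasoning
  halves : ∀ x → x ≡ ½ * (x + x)
  halves = solve 1 (λ x → x := con ½ :* (x :+ x)) ≡.refl

-- The recursion hands on only the pairs on the chosen side of the midpoint `c`. The others are
-- separated from the window by `c`, so a comparison with `c` classifies them. Each halving halves
-- the length and at least halves the weight, whence the factor `pow2inv n` in both. A value equal
-- to `c` belongs to the upper half, in accordance with half-open windows.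
lightWindow : ∀ n ws a h → 0ℚ ≤ h →
  LightWindow ws a (a + h) (pow2inv n * h) (pow2inv n * totalWidth₂ ws)
lightWindow zero ws a h 0≤h = record
  { start    = a
  ; heavy    = ws
  ; a≤start  = ≤-refl
  ; end≤b    = ≤-reflexive (cong (a +_) (*-identityˡ h))
  ; heavy≤κ  = ≤-reflexive (sym (*-identityˡ (totalWidth₂ ws)))
  ; classify = λ w∈ws → inj₂ (inj₂ w∈ws)
  }
lightWindow (suc n) ws a h 0≤h with ≤-total (totalWidth₂ below) (totalWidth₂ above)
  module Halves where
  c = a + ½ * h
  left? : Decidable (λ (w : ℚ × Pair) → proj₁ w < c)
  left? w = proj₁ w <? c
  below = filter left? ws
  above = filter (λ w → ¬? (left? w)) ws
  total = totalWidth-filter left? ws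
  0≤½h : 0ℚ ≤ ½ * h
  0≤½h = ≤-trans (≤-reflexive (sym (*-zeroʳ ½))) (*-monoˡ-≤-nonNeg ½ 0≤h)
  shift : ∀ p h → p * (½ * h) ≡ ½ * p * h
  shift = solve 2 (λ p h → p :* (con ½ :* h) := con ½ :* p :* h) ≡.refl
  end : ∀ a h → (a + ½ * h) + ½ * h ≡ a + h
  end = solve 2 (λ a h → (a :+ con ½ :* h) :+ con ½ :* h := a :+ h) ≡.refl
  width-≤ : ∀ {x} → x ≤ ½ * totalWidth₂ ws → pow2inv n * x ≤ pow2inv (suc n) * totalWidth₂ ws
  width-≤ x≤ = ≤-trans (*-monoˡ-≤-nonNeg (pow2inv n) {{nonNegative (<⇒≤ (pow2inv>0 n))}} x≤)
    (≤-reflexive (shift (pow2inv n) (totalWidth₂ ws)))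
  c≤a+h : c ≤ a + h
  c≤a+h = ≤-trans (p≤p+q 0≤½h) (≤-reflexive (end a h))
... | inj₁ below≤above = record
  { start    = start
  ; heavy    = heavy
  ; a≤start  = a≤start
  ; end≤b    = ≤-trans (≤-reflexive (cong (start +_) (sym (shift (pow2inv n) h)))) (≤-trans end≤b c≤a+h)
  ; heavy≤κ  = ≤-trans heavy≤κ (width-≤ (≤-half total below≤above))
  ; classify = λ {w} w∈ws → classify′ w w∈ws
  }
  where
  open Halves n ws a h 0≤h
  open LightWindow (lightWindow n below a (½ * h) 0≤½h)
  classify′ : ∀ w → w ∈ ws → proj₁ w < start ⊎ start + ½ * pow2inv n * h ≤ proj₁ w ⊎ w ∈ heavy
  classify′ w w∈ws with proj₁ w <? c
  ... | yes u<c = subst (λ δ → proj₁ w < start ⊎ start + δ ≤ proj₁ w ⊎ w ∈ heavy) (shift (pow2inv n) h)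
                    (classify (∈-filter⁺ left? w∈ws u<c))
  ... | no  u≮c = inj₂ (inj₁ (≤-trans (≤-reflexive (cong (start +_) (sym (shift (pow2inv n) h))))
                    (≤-trans end≤b (≮⇒≥ u≮c))))
... | inj₂ above≤below = record
  { start    = start
  ; heavy    = heavy
  ; a≤start  = ≤-trans (p≤p+q 0≤½h) a≤start
  ; end≤b    = ≤-trans (≤-reflexive (cong (start +_) (sym (shift (pow2inv n) h)))) (≤-trans end≤b (≤-reflexive (end a h)))
  ; heavy≤κ  = ≤-trans heavy≤κ (width-≤ (≤-half (≡.trans (+-comm (totalWidth₂ above) (totalWidth₂ below)) total) above≤below))
  ; classify = λ {w} w∈ws → classify′ w w∈ws
  }
  where
  open Halves n ws a h 0≤h
  open LightWindow (lightWindow n above c (½ * h) 0≤½h)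
  classify′ : ∀ w → w ∈ ws → proj₁ w < start ⊎ start + ½ * pow2inv n * h ≤ proj₁ w ⊎ w ∈ heavy
  classify′ w w∈ws with proj₁ w <? c
  ... | yes u<c = inj₁ (<-≤-trans u<c a≤start)
  ... | no  u≮c = subst (λ δ → proj₁ w < start ⊎ start + δ ≤ proj₁ w ⊎ w ∈ heavy) (shift (pow2inv n) h)
                    (classify (∈-filter⁺ (λ w → ¬? (left? w)) w∈ws u≮c))

-- Neighbourhoods of grid points, and the grid cell of a real

x-p<x : ∀ {x p} → 0ℚ < p → x - p < x
x-p<x {x} {p} 0<p = <-fromDifference 0<p (x-[x-p] x p)
  where
  x-[x-p] : ∀ x p → x - (x - p) ≡ p - 0ℚ
  x-[x-p] = solve 2 (λ x p → x :- (x :- p) := p :- con 0ℚ) ≡.refl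

-- The neighbourhood of `g K` has width `2^-(K+c+1)`. These widths form a geometric series, so the
-- total stays below `2^-c` however many points are covered.
pointCover : (ℕ → ℚ) → ℕ → ℕ → List Pair
pointCover g c zero    = []
pointCover g c (suc K) = ⟨ g K - δ , g K + δ ∣ <⇒≤ (<-trans (x-p<x {g K} 0<δ) (p<p+q {g K} 0<δ)) ⟩ ∷ pointCover g c K
  where
  δ = pow2inv (suc (suc (K ℕ.+ c)))
  0<δ = pow2inv>0 (suc (suc (K ℕ.+ c)))

-- Adding the unspent tail `2^-(K+c)` of the series makes the sum exact, and each new width is half
-- of that tail.
totalWidth-pointCover : ∀ g c K → totalWidth (pointCover g c K) + pow2inv (K ℕ.+ c) ≡ pow2inv c
totalWidth-pointCover g c zero    = +-identityˡ (pow2inv c)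
totalWidth-pointCover g c (suc K) = begin
  (((g K + δ) - (g K - δ)) + t) + pow2inv (suc (K ℕ.+ c))  ≡⟨ rearrange (g K) δ t (pow2inv (suc (K ℕ.+ c))) ⟩
  t + ((δ + δ) + pow2inv (suc (K ℕ.+ c)))
    ≡⟨ cong (λ z → t + (z + pow2inv (suc (K ℕ.+ c)))) (pow2inv-double (suc (K ℕ.+ c))) ⟩
  t + (pow2inv (suc (K ℕ.+ c)) + pow2inv (suc (K ℕ.+ c)))  ≡⟨ cong (t +_) (pow2inv-double (K ℕ.+ c)) ⟩
  t + pow2inv (K ℕ.+ c)                                    ≡⟨ totalWidth-pointCover g c K ⟩
  pow2inv c                                                ∎
  where
  open ≡-Reasoning
  δ = pow2inv (suc (suc (K ℕ.+ c)))
  t = totalWidth (pointCover g c K)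
  rearrange : ∀ x d t p → (((x + d) - (x - d)) + t) + p ≡ t + ((d + d) + p)
  rearrange = solve 4 (λ x d t p → (((x :+ d) :- (x :- d)) :+ t) :+ p := t :+ ((d :+ d) :+ p)) ≡.refl

totalWidth-pointCover-≤ : ∀ g c K → totalWidth (pointCover g c K) ≤ pow2inv c
totalWidth-pointCover-≤ g c K = subst (totalWidth (pointCover g c K) ≤_) (totalWidth-pointCover g c K)
  (p≤p+q (<⇒≤ (pow2inv>0 (K ℕ.+ c))))

-- Cotransitivity is applied on both sides of `q`. The only pair of answers that does not place `x`
-- relative to `q` is `l < x` with `x < r`, which is excluded.
outside⇒apart : ∀ {l q r} x → l < q → q < r → ¬ ((emb l <ℝ x) × (x <ℝ emb r)) → (emb q <ℝ x) ⊎ (x <ℝ emb q)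
outside⇒apart x l<q q<r x∉ with emb-cotransitive x l<q | emb-cotransitive x q<r
... | inj₂ x<q | _        = inj₂ x<q
... | inj₁ l<x | inj₁ q<x = inj₁ q<x
... | inj₁ l<x | inj₂ x<r = contradiction (l<x , x<r) x∉

pointCover-apart : ∀ {x} g c {K} → All (λ p → ¬ InInterval x p) (pointCover g c K) →
  ∀ {i} → i ℕ.< K → (emb (g i) <ℝ x) ⊎ (x <ℝ emb (g i))
pointCover-apart {x} g c {suc K} (x∉p ∷ x∉ps) i<1+K with ℕₚ.m<1+n⇒m<n∨m≡n i<1+K
... | inj₁ i<K    = pointCover-apart {x} g c {K} x∉ps i<K
... | inj₂ ≡.refl = outside⇒apart x (x-p<x {g K} 0<δ) (p<p+q {g K} 0<δ) x∉p
  where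
  δ = pow2inv (suc (suc (K ℕ.+ c)))
  0<δ = pow2inv>0 (suc (suc (K ℕ.+ c)))

-- A search downwards from `g M`: `x` lies above the lowest point and not above the highest, so the
-- answer of `apart` must change between two neighbours.
locate : ∀ {x} (g : ℕ → ℚ) M → (∀ {i} → i ℕ.< suc M → (emb (g i) <ℝ x) ⊎ (x <ℝ emb (g i))) →
  emb (g 0) <ℝ x → ¬ (emb (g M) <ℝ x) →
  Σ ℕ λ i → i ℕ.< M × (emb (g i) <ℝ x) × (x <ℝ emb (g (suc i)))
locate g zero    apart g₀<x g₀≮x = contradiction g₀<x g₀≮x
locate {x} g (suc M) apart g₀<x gₘ≮x with apart {suc M} ℕₚ.≤-refl | apart {M} (ℕₚ.n≤1+n (suc M))
... | inj₁ gₘ<x | _         = contradiction gₘ<x gₘ≮x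
... | inj₂ x<g  | inj₁ g<x  = M , ℕₚ.≤-refl , g<x , x<g
... | inj₂ _    | inj₂ x<g  =
  let i , i<M , g<x , x<g′ = locate {x} g M (λ i< → apart (ℕₚ.m<n⇒m<1+n i<)) g₀<x
                               (λ g<x → <-irrefl ≡.refl (emb<⇒<-emb x g<x x<g))
  in i , ℕₚ.m<n⇒m<1+n i<M , g<x , x<g′

-- Dyadic subdivision

dyadic : ℕ → ℕ → ℚ
dyadic m i = ℕtoℚ i * pow2inv m

dyadic-suc : ∀ m i → dyadic m (suc i) ≡ dyadic m i + pow2inv m
dyadic-suc m i = ≡.trans (cong (_* pow2inv m) (ℕtoℚ-suc i)) (expand (ℕtoℚ i) (pow2inv m))
  where
  expand : ∀ n p → (1ℚ + n) * p ≡ n * p + p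
  expand = solve 2 (λ n p → (con 1ℚ :+ n) :* p := n :* p :+ p) ≡.refl

dyadic-zero : ∀ m → dyadic m 0 ≡ 0ℚ
dyadic-zero m = *-zeroˡ (pow2inv m)

dyadic-+ : ∀ m i j → dyadic m (i ℕ.+ j) ≡ dyadic m i + dyadic m j
dyadic-+ m zero    j = sym (≡.trans (cong (_+ dyadic m j) (dyadic-zero m)) (+-identityˡ (dyadic m j)))
dyadic-+ m (suc i) j = begin
  dyadic m (suc (i ℕ.+ j))                  ≡⟨ dyadic-suc m (i ℕ.+ j) ⟩
  dyadic m (i ℕ.+ j) + pow2inv m            ≡⟨ cong (_+ pow2inv m) (dyadic-+ m i j) ⟩
  (dyadic m i + dyadic m j) + pow2inv m     ≡⟨ swap-right (dyadic m i) (dyadic m j) (pow2inv m) ⟩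
  (dyadic m i + pow2inv m) + dyadic m j     ≡⟨ cong (_+ dyadic m j) (dyadic-suc m i) ⟨
  dyadic m (suc i) + dyadic m j             ∎
  where open ≡-Reasoning

dyadic-double : ∀ m i → dyadic (suc m) (i ℕ.+ i) ≡ dyadic m i
dyadic-double m i = ≡.trans (dyadic-+ (suc m) i i) (halves (ℕtoℚ i) (pow2inv m))
  where
  halves : ∀ n p → n * (½ * p) + n * (½ * p) ≡ n * p
  halves = solve 2 (λ n p → n :* (con ½ :* p) :+ n :* (con ½ :* p) := n :* p) ≡.refl

dyadic-full : ∀ m → dyadic m (2 ℕ.^ m) ≡ 1ℚ
dyadic-full zero    = ≡.refl
dyadic-full (suc m) = ≡.trans (cong (λ k → dyadic (suc m) (2 ℕ.^ m ℕ.+ k)) (ℕₚ.+-identityʳ (2 ℕ.^ m)))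
  (≡.trans (dyadic-double m (2 ℕ.^ m)) (dyadic-full m))

dyadicInterval : ℕ → ℕ → Pair
dyadicInterval m i = ⟨ dyadic m i , dyadic m (suc i) ∣
  subst (dyadic m i ≤_) (sym (dyadic-suc m i)) (p≤p+q (<⇒≤ (pow2inv>0 m))) ⟩

width-dyadicInterval : ∀ m i → width (dyadicInterval m i) ≡ pow2inv m
width-dyadicInterval m i = ≡.trans (cong (_- dyadic m i) (dyadic-suc m i)) (x+y-x (dyadic m i) (pow2inv m))

totalWidth-tabulate : ∀ m n (f : Fin n → ℚ × Pair) → (∀ i → width (proj₂ (f i)) ≡ pow2inv m) →
  totalWidth₂ (tabulate f) ≡ dyadic m n
totalWidth-tabulate m zero    f width≡ = sym (dyadic-zero m)
totalWidth-tabulate m (suc n) f width≡ = begin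
  width (proj₂ (f Fin.zero)) + totalWidth₂ (tabulate (λ i → f (Fin.suc i)))
    ≡⟨ cong₂ _+_ (width≡ Fin.zero) (totalWidth-tabulate m n (λ i → f (Fin.suc i)) (λ i → width≡ (Fin.suc i))) ⟩
  pow2inv m + dyadic m n     ≡⟨ +-comm (pow2inv m) (dyadic m n) ⟩
  dyadic m n + pow2inv m     ≡⟨ dyadic-suc m n ⟨
  dyadic m (suc n)           ∎
  where open ≡-Reasoning

-- The grid has `2^m + 1` points, with 0 and 1 among them: `In01` gives weak inequalities only, and
-- the neighbourhoods of the two ends turn them into strict ones.
located : ∀ {x} m c → In01 x → All (λ p → ¬ InInterval x p) (pointCover (dyadic m) c (suc (2 ℕ.^ m))) →
  Σ (Fin (2 ℕ.^ m)) λ i → (emb (dyadic m (toℕ i)) <ℝ x) × (x <ℝ emb (dyadic m (suc (toℕ i))))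
located {x} m c (0≤x , x≤1) x∉ =
  let i , i<M , g<x , x<g = locate {x} (dyadic m) (2 ℕ.^ m) apart dyadic₀<x dyadic₁≮x
  in fromℕ< i<M ,
     subst (λ k → emb (dyadic m k) <ℝ x) (sym (toℕ-fromℕ< i<M)) g<x ,
     subst (λ k → x <ℝ emb (dyadic m (suc k))) (sym (toℕ-fromℕ< i<M)) x<g
  where
  apart : ∀ {i} → i ℕ.< suc (2 ℕ.^ m) → (emb (dyadic m i) <ℝ x) ⊎ (x <ℝ emb (dyadic m i))
  apart = pointCover-apart {x} (dyadic m) c x∉
  dyadic₀<x : emb (dyadic m 0) <ℝ x
  dyadic₀<x with apart {0} (ℕ.s≤s ℕ.z≤n)
  ... | inj₁ 0<x = 0<x
  ... | inj₂ x<0 = contradiction (subst (λ q → x <ℝ emb q) (dyadic-zero m) x<0) 0≤x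
  dyadic₁≮x : ¬ (emb (dyadic m (2 ℕ.^ m)) <ℝ x)
  dyadic₁≮x 1<x = x≤1 (subst (λ q → emb q <ℝ x) (dyadic-full m) 1<x)

pow2inv-quadruple : ∀ n → ((pow2inv (2 ℕ.+ n) + pow2inv (2 ℕ.+ n)) + pow2inv (2 ℕ.+ n)) + pow2inv (2 ℕ.+ n) ≡ pow2inv n
pow2inv-quadruple n = quarters (pow2inv n)
  where
  quarters : ∀ p → ((½ * (½ * p) + ½ * (½ * p)) + ½ * (½ * p)) + ½ * (½ * p) ≡ p
  quarters = solve 1 (λ p → ((con ½ :* (con ½ :* p) :+ con ½ :* (con ½ :* p)) :+ con ½ :* (con ½ :* p)) :+ con ½ :* (con ½ :* p) := p) ≡.refl

-- Construction of y

-- The strict inequalities at both ends finally give `u < y < v`, and `narrow` makes the nested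
-- intervals dwindle to one real.
record Refinement (f : PFun) (n : ℕ) (a b : ℚ) : Set where
  field
    a′ b′    : ℚ
    a<a′     : a < a′
    a′<b′    : a′ < b′
    b′<b     : b′ < b
    narrow   : b′ - a′ < pow2inv n
    α        : ℕ → Pair
    measure  : MeasurableBelow α (pow2inv n)
    avoids   : ∀ x → In01 x → ¬ InH α x → Σ (Dom f x) λ d → (app f x d <ℝ emb a′) ⊎ (emb b′ <ℝ app f x d)

module _ (f : PFun) (n : ℕ) {a b : ℚ} (a<b : a < b) (β : ℕ → Pair)
  (μβ : MeasurableBelow β (pow2inv (2 ℕ.+ n))) (β⊆ : ∀ x → In01 x → ¬ InH β x → Dom f x)
  (k : ℕ) (n<k : n ℕ.< k) (4η<h : ((pow2inv k + pow2inv k) + pow2inv k) + pow2inv k < pow2inv (2 ℕ.+ n) * (b - a))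
  (m : ℕ) (u : Fin (2 ℕ.^ m) → ℚ) (γ : ℕ → Pair) (μγ : MeasurableBelow γ (pow2inv (k ℕ.+ 2)))
  (u≈f : ∀ x (d : Dom f x) (i : Fin (2 ℕ.^ m)) → ¬ InH γ x →
     emb (dyadic m (toℕ i)) <ℝ x → x <ℝ emb (dyadic m (suc (toℕ i))) →
     AbsDiffLt (app f x d) (u i) (pow2inv (k ℕ.+ 1)))
  where

  private
    q = pow2inv (2 ℕ.+ n)
    η = pow2inv k
    h = q * (b - a)

    η>0 : 0ℚ < η
    η>0 = pow2inv>0 k

    steps : List (ℚ × Pair)
    steps = tabulate (λ i → u i , dyadicInterval m (toℕ i))

    totalWidth-steps : totalWidth₂ steps ≡ 1ℚ
    totalWidth-steps = ≡.trans (totalWidth-tabulate m (2 ℕ.^ m) _ (λ i → width-dyadicInterval m (toℕ i))) (dyadic-full m)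

    open LightWindow (lightWindow (2 ℕ.+ n) steps a (b - a) (<⇒≤ (x<y⇒0<y-x a<b)))

    heavies grid : List Pair
    heavies = map proj₂ heavy
    grid    = pointCover (dyadic m) (2 ℕ.+ n) (suc (2 ℕ.^ m))

    heavies≤q : totalWidth heavies ≤ q
    heavies≤q = ≤-trans heavy≤κ (≤-reflexive (≡.trans (cong (q *_) totalWidth-steps) (*-identityʳ q)))

    α : ℕ → Pair
    α = grid ++ˢ heavies ++ˢ interleave β γ

    γ-bound : pow2inv (k ℕ.+ 2) ≤ q
    γ-bound = pow2inv-antitone (ℕₚ.≤-trans (ℕₚ.≤-reflexive (ℕₚ.+-comm 2 n)) (ℕₚ.+-monoˡ-≤ 2 (ℕₚ.<⇒≤ n<k)))

    measure : MeasurableBelow α (pow2inv n)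
    measure = convergesBelow⇒measurableBelow (convergesBelow-weaken total≤
      (convergesBelow-++ˢ grid (convergesBelow-++ˢ heavies (convergesBelow-interleave β γ
        (measurableBelow⇒convergesBelow μβ) (measurableBelow⇒convergesBelow μγ)))))
      where
      -- Four portions of at most `2^-(n+2)` each: the cover outside of which `f` is defined, the
      -- exceptional set of the step function, the heavy dyadic intervals, and the neighbourhoods of
      -- the grid points.
      total≤ : ((q + pow2inv (k ℕ.+ 2)) + totalWidth heavies) + totalWidth grid ≤ pow2inv n
      total≤ = ≤-trans
        (+-mono-≤ (+-mono-≤ (+-monoʳ-≤ q γ-bound) heavies≤q)
                  (totalWidth-pointCover-≤ (dyadic m) (2 ℕ.+ n) (suc (2 ℕ.^ m))))
        (≤-reflexive (pow2inv-quadruple n))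

    end≤b′ : start + h ≤ b
    end≤b′ = ≤-trans end≤b (≤-reflexive (a+[b-a] a b))
      where
      a+[b-a] : ∀ a b → a + (b - a) ≡ b
      a+[b-a] = solve 2 (λ a b → a :+ (b :- a) := b) ≡.refl

    a′ b′ : ℚ
    -- The first `η` of the window absorbs the deviation of `f` from step values below it, the
    -- second is the new interval, and the third absorbs the deviation from values above. The fourth
    -- in `4η<h` is spare.
    a′ = start + η
    b′ = a′ + η

    b′+η<end : b′ + η < start + h
    b′+η<end = <-trans (p<p+q η>0) (subst (_< start + h) (regroup start η) (+-monoʳ-< start 4η<h))
      where
      regroup : ∀ s e → s + (((e + e) + e) + e) ≡ (((s + e) + e) + e) + e
      regroup = solve 2 (λ s e → s :+ (((e :+ e) :+ e) :+ e) := (((s :+ e) :+ e) :+ e) :+ e) ≡.refl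

    accuracy≤η : pow2inv (k ℕ.+ 1) ≤ η
    accuracy≤η = pow2inv-antitone (ℕₚ.m≤m+n k 1)

    below : ∀ z v → v < start → z <ℝ emb (v + pow2inv (k ℕ.+ 1)) → z <ℝ emb a′
    below z v v<start (i , z<) = i , <-trans z< (+-mono-<-≤ v<start accuracy≤η)

    above : ∀ z v → start + h ≤ v → emb (v - pow2inv (k ℕ.+ 1)) <ℝ z → emb b′ <ℝ z
    above z v end≤v (i , <z) = i , <-trans
      (<-≤-trans b′<v-η (+-monoʳ-≤ v (neg-antimono-≤ accuracy≤η))) <z
      where
      x-y-z : ∀ x y z → (x - y) - z ≡ x - (z + y)
      x-y-z = solve 3 (λ x y z → (x :- y) :- z := x :- (z :+ y)) ≡.refl
      b′<v-η : b′ < v - η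
      b′<v-η = <-fromDifference (<-≤-trans b′+η<end end≤v) (x-y-z v η b′)

    avoids : ∀ x → In01 x → ¬ InH α x → Σ (Dom f x) λ d → (app f x d <ℝ emb a′) ⊎ (emb b′ <ℝ app f x d)
    avoids x 0≤x≤1 x∉α = d , conclude (classify (∈-tabulate⁺ {f = λ i → u i , dyadicInterval m (toℕ i)} i))
      where
      x∉tail : ¬ InH (heavies ++ˢ interleave β γ) x
      x∉tail = ∉-++ˢʳ {x = x} grid x∉α
      x∉βγ : ¬ InH (interleave β γ) x
      x∉βγ = ∉-++ˢʳ {x = x} heavies x∉tail
      d : Dom f x
      d = β⊆ x 0≤x≤1 (∉-interleaveˡ β γ {x} x∉βγ)
      position = located {x} m (2 ℕ.+ n) 0≤x≤1 (∉-++ˢˡ {x = x} grid x∉α)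
      i = proj₁ position
      close : AbsDiffLt (app f x d) (u i) (pow2inv (k ℕ.+ 1))
      close = u≈f x d i (∉-interleaveʳ β γ {x} x∉βγ) (proj₁ (proj₂ position)) (proj₂ (proj₂ position))
      conclude : u i < start ⊎ start + h ≤ u i ⊎ (u i , dyadicInterval m (toℕ i)) ∈ heavy →
        (app f x d <ℝ emb a′) ⊎ (emb b′ <ℝ app f x d)
      conclude (inj₁ u<start)        = inj₁ (below (app f x d) (u i) u<start (proj₂ close))
      conclude (inj₂ (inj₁ end≤u))   = inj₂ (above (app f x d) (u i) end≤u (proj₁ close))
      -- For a heavy value, `x` would lie in a dyadic interval that was deleted.
      conclude (inj₂ (inj₂ ∈heavy))  = contradiction (proj₂ position)
        (All.lookup (∉-++ˢˡ {x = x} heavies x∉tail) (∈-map⁺ proj₂ ∈heavy))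

  refinement : Refinement f n a b
  refinement = record
    { a′      = a′
    ; b′      = b′
    ; a<a′    = ≤-<-trans a≤start (p<p+q η>0)
    ; a′<b′   = p<p+q η>0
    ; b′<b    = <-trans (p<p+q η>0) (<-≤-trans b′+η<end end≤b′)
    ; narrow  = subst (_< pow2inv n) (sym (x+y-x a′ η)) (pow2inv-antitone-< n<k)
    ; α       = α
    ; measure = measure
    ; avoids  = avoids
    }

refine : ∀ f → AlmostFullFun f → MeasurableFun f → ∀ n {a b} → a < b → Refinement f n a b
refine f full meas n {a} {b} a<b =
  let β , μβ , β⊆              = full (2 ℕ.+ n)
      j , p<h                  = archimedean 0<h
      -- The summand 2 makes `4 * 2^-k` equal to `2^-(j+n)`, which is at most `2^-j` and so below
      -- `h`. The summand `n` gives `2^-k < 2^-n`, as `narrow` and the measure of `γ` require.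
      k                        = 2 ℕ.+ (j ℕ.+ n)
      m , u , _ , γ , μγ , u≈f = meas k
  in refinement f n a<b β μβ β⊆ k (n<k j) (4η<h j p<h) m u γ μγ u≈f
  where
  h = pow2inv (2 ℕ.+ n) * (b - a)
  0<h : 0ℚ < h
  0<h = subst (_< h) (*-zeroʳ (pow2inv (2 ℕ.+ n)))
    (*-monoʳ-<-pos (pow2inv (2 ℕ.+ n)) {{pow2inv-pos (2 ℕ.+ n)}} (x<y⇒0<y-x a<b))
  n<k : ∀ j → n ℕ.< 2 ℕ.+ (j ℕ.+ n)
  n<k j = ℕ.s≤s (ℕₚ.m≤n⇒m≤1+n (ℕₚ.m≤n+m n j))
  4η<h : ∀ j → pow2inv j < h →
    ((pow2inv (2 ℕ.+ (j ℕ.+ n)) + pow2inv (2 ℕ.+ (j ℕ.+ n))) + pow2inv (2 ℕ.+ (j ℕ.+ n))) + pow2inv (2 ℕ.+ (j ℕ.+ n)) < h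
  4η<h j p<h = subst (_< h) (sym (pow2inv-quadruple (j ℕ.+ n))) (≤-<-trans (pow2inv-antitone (ℕₚ.m≤m+n j n)) p<h)

record Interval : Set where
  constructor interval
  field
    {left right} : ℚ
    left<right   : left < right
open Interval

module _ (f : PFun) (full : AlmostFullFun f) (meas : MeasurableFun f) {u v : ℚ} (u<v : u < v) where

  open Refinement

  nested : ℕ → Interval
  nestedRefinement : ∀ n → Refinement f n (left (nested n)) (right (nested n))
  nested zero    = interval u<v
  nested (suc n) = interval (a′<b′ (nestedRefinement n))
  nestedRefinement n = refine f full meas n (left<right (nested n))

  nestedPoint : ℝ
  nestedPoint = record
    { lo      = λ n → left (nested n)
    ; hi      = λ n → right (nested n)
    ; lo≤hi   = λ n → <⇒≤ (left<right (nested n))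
    ; lo-mono = λ n → <⇒≤ (a<a′ (nestedRefinement n))
    ; hi-mono = λ n → <⇒≤ (b′<b (nestedRefinement n))
    -- Interval `suc m` is the one produced by the refinement of stage `m`.
    ; dwindle = λ m → suc m , narrow (nestedRefinement m)
    }

  <left⇒<nestedPoint : ∀ {z} n → z <ℝ emb (left (nested n)) → z <ℝ nestedPoint
  <left⇒<nestedPoint {z} n (i , z<left) = i ℕ.⊔ n , ≤-<-trans
    (stepwise-antitone (hi z) (hi-mono z) (ℕₚ.m≤m⊔n i n))
    (<-≤-trans z<left (stepwise-monotone (lo nestedPoint) (lo-mono nestedPoint) (ℕₚ.m≤n⊔m i n)))

  right<⇒nestedPoint< : ∀ {z} n → emb (right (nested n)) <ℝ z → nestedPoint <ℝ z
  right<⇒nestedPoint< {z} n (i , right<z) = i ℕ.⊔ n , ≤-<-trans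
    (stepwise-antitone (hi nestedPoint) (hi-mono nestedPoint) (ℕₚ.m≤n⊔m i n))
    (<-≤-trans right<z (stepwise-monotone (lo z) (lo-mono z) (ℕₚ.m≤m⊔n i n)))

  -- Since `y` lies in every nested interval, being outside interval `suc n` already separates
  -- `f(x)` from `y`. So the deleted set of the single stage `n` serves for the bound `2^-n`,
  -- without a union over stages.
  apartFromNestedPoint : ∀ n x → In01 x → ¬ InH (α (nestedRefinement n)) x →
    In01 x × Σ (Dom f x) λ d → (app f x d <ℝ nestedPoint) ⊎ (nestedPoint <ℝ app f x d)
  apartFromNestedPoint n x 0≤x≤1 x∉α =
    let d , outside = avoids (nestedRefinement n) x 0≤x≤1 x∉α
    in 0≤x≤1 , d , Sum.map (<left⇒<nestedPoint {app f x d} (suc n)) (right<⇒nestedPoint< {app f x d} (suc n)) outside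

theorem5p18 : FanTheorem → (f : PFun) → AlmostFullFun f → MeasurableFun f →
    (u v : ℚ) → - 1ℚ ≤ u → u < v → v ≤ 1ℚ →
    Σ ℝ λ y → (emb u <ℝ y) × (y <ℝ emb v) ×
    AlmostFull (λ x → In01 x × Σ (Dom f x) λ d → (app f x d <ℝ y) ⊎ (y <ℝ app f x d))
theorem5p18 _ f full meas u v _ u<v _ =
  nestedPoint f full meas u<v ,
  -- Index 1, because interval 0 is `(u , v)` itself and the first refinement lies strictly inside
  -- it.
  (1 , a<a′ (R 0)) ,
  (1 , b′<b (R 0)) ,
  λ n → α (R n) , measure (R n) , apartFromNestedPoint f full meas u<v n
  where
  open Refinement
  R = nestedRefinement f full meas u<v
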